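{- Let $\mathbf{A}$ be a finite simple non-abelian Mal'cev algebra with idempotents $e_1,\dots,e_n$ in (pairwise) distinct $\operatorname{Aut}\mathbf{A}$-orbits, let $\mathbf{B}$ be a Boolean algebra with Stone space $X$, let $x_1,\dots,x_n\in X$ be distinct, and let $X^\circ := X\setminus\{x_1,\dots,x_n\}$. Write $\mathbf{D} := (\mathbf{A}^{\mathbf{B}})^{x_1,\dots,x_n}_{e_1,\dots,e_n}$. For $\varphi\in\operatorname{Aut}\mathbf{D}$ and $x\in X$ define $\overline{\varphi}(x) := x$ if $x\in\{x_1,\dots,x_n\}$ and $\overline{\varphi}(x) := \varphi^\circ(x)$ otherwise. (1) The mapping $$h\colon \operatorname{Aut}\mathbf{D}\to(\operatorname{Homeo} X)_{\{x_1,\dots,x_n\}},\quad \varphi\mapsto\overline{\varphi},$$ is a group epimorphism, and $$\operatorname{Aut}\mathbf{D}\cong \ker h\rtimes(\operatorname{Homeo} X)_{\{x_1,\dots,x_n\}}.$$ (2) Let $K\subseteq(\operatorname{Aut}\mathbf{A})^{X^\circ}$ be the set of all continuous maps $\psi\colon X^\circ\to\operatorname{Aut}\mathbf{A}$ such that $\psi^{ -1}((\operatorname{Aut}\mathbf{A})_{e_i})\cup\{x_i\}$ is open in $X$ for each $i\in\{1,\dots,n\}$. Then $$p\colon\ker h\to K,\quad \varphi\mapsto\varphi_*,$$ is a group isomorphism.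
   Context: An algebra is Mal'cev if it has a ternary term operation $m$ satisfying $m(x,x,y)=y=m(y,x,x)$. A Mal'cev algebra is abelian if its basic operations can be represented as affine functions over a module; otherwise it is non-abelian. An element $e$ of $\mathbf{A}$ is an idempotent if $\{e\}$ is a subalgebra of $\mathbf{A}$. Here $n\geq 0$. The Stone space $X$ of a Boolean algebra $\mathbf{B}$ is its set of ultrafilters with basic open sets $\{x\in X : b\in x\}$, $b\in B$. The Boolean power $\mathbf{A}^{\mathbf{B}}$ is the subalgebra of the direct power $\mathbf{A}^X$ whose elements are the continuous functions $f\colon X\to A$, where $A$ is discrete. The filtered Boolean power $(\mathbf{A}^{\mathbf{B}})^{x_1,\dots,x_n}_{e_1,\dots,e_n}$ is the subalgebra of $\mathbf{A}^{\mathbf{B}}$ with universe $\{f\in A^{\mathbf{B}} : f(x_1)=e_1,\dots,f(x_n)=e_n\}$. $X^\circ$ has the subspace topology and $\operatorname{Aut}\mathbf{A}$ is discrete. $(\operatorname{Homeo} X)_{\{x_1,\dots,x_n\}}$ is the group of homeomorphisms of $X$ fixing each $x_i$, and $(\operatorname{Aut}\mathbf{A})_{e_i}$ is the stabilizer of $e_i$. The group operation on $(\operatorname{Aut}\mathbf{A})^{X^\circ}$ is pointwise. The symbol $\rtimes$ denotes a semidirect product (with respect to a suitable action), with $\ker h$ the normal factor. For $x\in X$ let $\pi_x\colon\mathbf{D}\to\mathbf{A}$, $f\mapsto f(x)$, and $\theta_x:=\ker\pi_x=\{(f,g)\in D^2: f(x)=g(x)\}$. For $\varphi\in\operatorname{Aut}\mathbf{D}$,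 the map $\varphi^\circ\colon X^\circ\to X^\circ$ is the (well-defined) homeomorphism determined by $\varphi(\theta_x)=\theta_{\varphi^\circ(x)}$, where $\varphi(\theta_x):=\{(\varphi(f),\varphi(g)) : (f,g)\in\theta_x\}$. For $x\in X^\circ$, $\varphi_x\in\operatorname{Aut}\mathbf{A}$ is the (well-defined) automorphism determined by $\varphi_x\pi_x=\pi_{\varphi^\circ(x)}\varphi$, i.e. $\varphi_x(f(x))=\varphi(f)(\varphi^\circ(x))$ for all $f\in D$. Finally $\varphi_*\colon X^\circ\to\operatorname{Aut}\mathbf{A}$ is the map $x\mapsto\varphi_x$. -}

module Defs where

open import Level using (Setω; _⊔_) renaming (suc to lsuc)
open import Algebra.Bundles using (Group; RawMonoid; Ring)
open import Algebra.Lattice.Bundles using (BooleanAlgebra)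
open import Algebra.Module.Structures using (IsLeftModule)
open import Algebra.Morphism.Bundles using (GroupHomomorphism)
open import Algebra.Morphism.Structures using (module GroupMorphisms)
import Algebra.Construct.Pointwise as Pointwise
import Algebra.Definitions.RawMonoid as RawMonoidDefs
import Algebra.Properties.Group as GroupProperties
import Function.Construct.Composition as Comp
import Function.Construct.Identity as Id
import Function.Construct.Symmetry as Sym
open import Axiom.ExcludedMiddle using (ExcludedMiddle)
open import Data.Empty using (⊥-elim)
open import Data.Fin.Base using (Fin; zero; suc)
open import Data.Nat.Base using (ℕ; zero; suc)
open import Data.Product using (Σ; Σ-syntax; ∃; ∃-syntax; _×_; _,_; proj₁; proj₂)
open import Data.Sum.Base using (_⊎_; inj₁; inj₂)
open import Function.Base using (_∘_)
open import Function.Bundles using (Inverse)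
open import Function.Definitions using (Surjective)
open import Relation.Binary.Bundles using (Setoid)
open import Relation.Binary.Core using (Rel; _⇒_; _⇔_)
open import Relation.Binary.Definitions using (_Respects_)
open import Relation.Binary.PropositionalEquality.Core using (_≡_)
import Relation.Binary.PropositionalEquality.Properties as ≡
open import Relation.Binary.Structures using (IsEquivalence)
open import Relation.Nullary.Decidable.Core using (yes; no)
open import Relation.Nullary.Negation.Core using (¬_)
open import Relation.Unary using (Pred; _∈_; _∉_; _⊆_; _∩_; _≐_)

-- The classical metatheory.  As `Dec P` carries a witness of `P` for
-- arbitrary types `P`, this also yields choice.
Classical : Setω
Classical = ∀ {ℓ} → ExcludedMiddle ℓ

------------------------------------------------------------------------
-- Groups

record IsSubgroup {c ℓ p} (G : Group c ℓ) (P : Pred (Group.Carrier G) p)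
                  : Set (c ⊔ p) where
  open Group G
  field
    ∙-closed  : ∀ {g h} → g ∈ P → h ∈ P → g ∙ h ∈ P
    ε-closed  : ε ∈ P
    ⁻¹-closed : ∀ {g} → g ∈ P → g ⁻¹ ∈ P

subgroup : ∀ {c ℓ p} (G : Group c ℓ) {P : Pred (Group.Carrier G) p} →
           IsSubgroup G P → Group (c ⊔ p) ℓ
subgroup G {P} P-sub = record
  { Carrier = Σ Carrier P
  ; _≈_     = λ g h → proj₁ g ≈ proj₁ h
  ; _∙_     = λ g h → proj₁ g ∙ proj₁ h , ∙-closed (proj₂ g) (proj₂ h)
  ; ε       = ε , ε-closed
  ; _⁻¹     = λ g → proj₁ g ⁻¹ , ⁻¹-closed (proj₂ g)
  ; isGroup = record
    { isMonoid = record
      { isSemigroup = record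
        { isMagma = record
          { isEquivalence = record { refl = refl ; sym = sym ; trans = trans }
          ; ∙-cong        = ∙-cong
          }
        ; assoc = λ f g h → assoc (proj₁ f) (proj₁ g) (proj₁ h)
        }
      ; identity = (λ g → identityˡ (proj₁ g)) , (λ g → identityʳ (proj₁ g))
      }
    ; inverse = (λ g → inverseˡ (proj₁ g)) , (λ g → inverseʳ (proj₁ g))
    ; ⁻¹-cong = ⁻¹-cong
    }
  }
  where
  open Group G
  open IsSubgroup P-sub

permutationGroup : ∀ {c ℓ} → Setoid c ℓ → Group (c ⊔ ℓ) (c ⊔ ℓ)
permutationGroup S = record
  { Carrier = Inverse S S
  ; _≈_     = λ f g → ∀ x → to f x ≈ to g x
  ; _∙_     = λ f g → Comp.inverse g f
  ; ε       = Id.inverse S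
  ; _⁻¹     = Sym.inverse
  ; isGroup = record
    { isMonoid = record
      { isSemigroup = record
        { isMagma = record
          { isEquivalence = record
            { refl  = λ _ → refl
            ; sym   = λ p x → sym (p x)
            ; trans = λ p q x → trans (p x) (q x)
            }
          ; ∙-cong = λ {f} {f′} {g} {g′} p q x →
              trans (to-cong f (q x)) (p (to g′ x))
          }
        ; assoc = λ _ _ _ _ → refl
        }
      ; identity = (λ _ _ → refl) , (λ _ _ → refl)
      }
    ; inverse = (λ f x → inverseʳ f refl) , (λ f x → inverseˡ f refl)
    ; ⁻¹-cong = λ {f} {g} p x →
        inverseʳ f (trans (sym (inverseˡ g refl)) (sym (p (from g x))))
    }
  }
  where
  open Setoid S
  open Inverse

module _ {c ℓ c′ ℓ′} (G : Group c ℓ) (H : Group c′ ℓ′) where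

  private
    module G = Group G
    module H = Group H

  open GroupMorphisms G.rawGroup H.rawGroup

  IsHom : (G.Carrier → H.Carrier) → Set (c ⊔ ℓ ⊔ ℓ′)
  IsHom = IsGroupHomomorphism

  IsIso : (G.Carrier → H.Carrier) → Set (c ⊔ c′ ⊔ ℓ ⊔ ℓ′)
  IsIso = IsGroupIsomorphism

  IsEpi : (G.Carrier → H.Carrier) → Set (c ⊔ c′ ⊔ ℓ ⊔ ℓ′)
  IsEpi f = IsHom f × Surjective G._≈_ H._≈_ f

  infix 4 _≅_
  _≅_ : Set (c ⊔ c′ ⊔ ℓ ⊔ ℓ′)
  _≅_ = ∃ IsIso

  kernel : ∀ {f} → IsHom f → Group (c ⊔ ℓ′) ℓ
  kernel {f} f-hom = subgroup G {λ g → f g H.≈ H.ε} record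
    { ∙-closed  = λ {g} {h} p q →
        H.trans (homo g h) (H.trans (H.∙-cong p q) (H.identityˡ H.ε))
    ; ε-closed  = ε-homo
    ; ⁻¹-closed = λ {g} p →
        H.trans (⁻¹-homo g) (H.trans (H.⁻¹-cong p) (GroupProperties.ε⁻¹≈ε H))
    }
    where open IsGroupHomomorphism f-hom

groupAut : ∀ {c ℓ} → Group c ℓ → Group (c ⊔ ℓ) (c ⊔ ℓ)
groupAut G = subgroup (permutationGroup G.setoid) {λ f → IsHom G G (to f)} record
  { ∙-closed  = λ {f} {g} p q → mkHom (Comp.inverse g f) λ x y → G.trans
      (to-cong f (homo q x y)) (homo p (to g x) (to g y))
  ; ε-closed  = mkHom (Id.inverse G.setoid) λ _ _ → G.refl
  ; ⁻¹-closed = λ {f} p → mkHom (Sym.inverse f) λ x y → inverseʳ f (G.sym (G.trans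
      (homo p (from f x) (from f y))
      (G.∙-cong (inverseˡ f G.refl) (inverseˡ f G.refl))))
  }
  where
  module G = Group G
  open Inverse
  open GroupMorphisms.IsGroupHomomorphism using (homo)
  open GroupProperties G using (inverseˡ-unique; identityˡ-unique)

  mkHom : (f : Inverse G.setoid G.setoid) →
          (∀ x y → to f (x G.∙ y) G.≈ to f x G.∙ to f y) → IsHom G G (to f)
  mkHom f f-∙ = record
    { isMonoidHomomorphism = record
      { isMagmaHomomorphism = record
        { isRelHomomorphism = record { cong = to-cong f }
        ; homo = f-∙
        }
      ; ε-homo = f-ε
      }
    ; ⁻¹-homo = λ x → inverseˡ-unique (to f (x G.⁻¹)) (to f x)
        (G.trans (G.sym (f-∙ (x G.⁻¹) x)) (G.trans (to-cong f (G.inverseˡ x)) f-ε))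
    }
    where
    f-ε : to f G.ε G.≈ G.ε
    f-ε = identityˡ-unique _ _
      (G.trans (G.sym (f-∙ G.ε G.ε)) (to-cong f (G.identityˡ G.ε)))

Action : ∀ {c ℓ c′ ℓ′} → Group c′ ℓ′ → Group c ℓ → Set (c ⊔ ℓ ⊔ c′ ⊔ ℓ′)
Action H N = GroupHomomorphism (Group.rawGroup H) (Group.rawGroup (groupAut N))

-- The external semidirect product, with normal factor `N`.
semidirect : ∀ {c ℓ c′ ℓ′} (N : Group c ℓ) (H : Group c′ ℓ′) →
             Action H N → Group (c ⊔ c′) (ℓ ⊔ ℓ′)
semidirect N H α = record
  { Carrier = N.Carrier × H.Carrier
  ; _≈_     = λ (n , h) (n′ , h′) → n N.≈ n′ × h H.≈ h′
  ; _∙_     = λ (n , h) (n′ , h′) → n N.∙ act h n′ , h H.∙ h′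
  ; ε       = N.ε , H.ε
  ; _⁻¹     = λ (n , h) → act (h H.⁻¹) (n N.⁻¹) , h H.⁻¹
  ; isGroup = record
    { isMonoid = record
      { isSemigroup = record
        { isMagma = record
          { isEquivalence = record
            { refl  = N.refl , H.refl
            ; sym   = λ (p , q) → N.sym p , H.sym q
            ; trans = λ (p , q) (p′ , q′) → N.trans p p′ , H.trans q q′
            }
          ; ∙-cong = λ (p , q) (p′ , q′) →
              N.∙-cong p (act-cong q p′) , H.∙-cong q q′
          }
        ; assoc = λ (n , h) (n′ , h′) (n″ , h″) →
            N.trans (N.assoc _ _ _)
              (N.∙-congˡ (N.trans (N.∙-congˡ (α.homo h h′ n″))
                                  (N.sym (act-∙ h _ _))))
          , H.assoc h h′ h″
        }
      ; identity = (λ (n , h) → N.trans (N.identityˡ _) (α.ε-homo n) , H.identityˡ h)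
                 , (λ (n , h) → N.trans (N.∙-congˡ (act-ε h)) (N.identityʳ n)
                              , H.identityʳ h)
      }
    ; inverse = (λ (n , h) → N.trans (N.sym (act-∙ (h H.⁻¹) _ _))
                               (N.trans (act-cong H.refl (N.inverseˡ n))
                                        (act-ε (h H.⁻¹)))
                           , H.inverseˡ h)
              , (λ (n , h) → N.trans (N.∙-congˡ (N.trans
                                 (N.sym (α.homo h (h H.⁻¹) (n N.⁻¹)))
                                 (N.trans (α.⟦⟧-cong (H.inverseʳ h) (n N.⁻¹))
                                          (α.ε-homo (n N.⁻¹)))))
                               (N.inverseʳ n)
                           , H.inverseʳ h)
    ; ⁻¹-cong = λ (p , q) → act-cong (H.⁻¹-cong q) (N.⁻¹-cong p) , H.⁻¹-cong q
    }
  }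
  where
  module N = Group N
  module H = Group H
  module α = GroupHomomorphism α
  open GroupMorphisms.IsGroupHomomorphism using (homo; ε-homo)

  act : H.Carrier → N.Carrier → N.Carrier
  act h = Inverse.to (proj₁ (α.⟦ h ⟧))

  act-∙ : ∀ h n n′ → act h (n N.∙ n′) N.≈ act h n N.∙ act h n′
  act-∙ h = homo (proj₂ (α.⟦ h ⟧))

  act-ε : ∀ h → act h N.ε N.≈ N.ε
  act-ε h = ε-homo (proj₂ (α.⟦ h ⟧))

  act-cong : ∀ {h h′ n n′} → h H.≈ h′ → n N.≈ n′ → act h n N.≈ act h′ n′
  act-cong {h} {n′ = n′} p q =
    N.trans (Inverse.to-cong (proj₁ (α.⟦ h ⟧)) q) (α.⟦⟧-cong p n′)

------------------------------------------------------------------------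
-- Universal algebra

record Signature s : Set (lsuc s) where
  field
    Op    : Set s
    arity : Op → ℕ

record Algebra {s} (S : Signature s) c ℓ : Set (s ⊔ lsuc (c ⊔ ℓ)) where
  open Signature S
  field
    setoid : Setoid c ℓ
  open Setoid setoid public
  field
    op      : (o : Op) → (Fin (arity o) → Carrier) → Carrier
    op-cong : ∀ o {u v} → (∀ j → u j ≈ v j) → op o u ≈ op o v

data Term {s} (S : Signature s) (V : Set) : Set s where
  var : V → Term S V
  app : (o : Signature.Op S) → (Fin (Signature.arity S o) → Term S V) → Term S V

Finite : ∀ {c ℓ} → Setoid c ℓ → Set (c ⊔ ℓ)
Finite S = ∃[ k ] Inverse S (≡.setoid (Fin k))

module _ {s} {S : Signature s} {c ℓ} (A : Algebra S c ℓ) where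

  open Signature S
  open Algebra A using (Carrier; _≈_; setoid; op; op-cong; refl; sym; trans)

  eval : ∀ {V} → Term S V → (V → Carrier) → Carrier
  eval (var v)    ρ = ρ v
  eval (app o ts) ρ = op o (λ j → eval (ts j) ρ)

  ⟨_,_,_⟩ : Carrier → Carrier → Carrier → Fin 3 → Carrier
  ⟨ a , b , d ⟩ zero             = a
  ⟨ a , b , d ⟩ (suc zero)       = b
  ⟨ a , b , d ⟩ (suc (suc zero)) = d

  Mal'cev : Set (s ⊔ c ⊔ ℓ)
  Mal'cev = Σ[ m ∈ Term S (Fin 3) ] (∀ a b →
    (eval m ⟨ a , a , b ⟩ ≈ b) × (eval m ⟨ b , a , a ⟩ ≈ b))

  -- The operations of a (left, unital) module on the carrier of `A` over which
  -- every basic operation is of the form `v ↦ Σⱼ rⱼ vⱼ + d`.  The ring may be taken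
  -- at the level of the endomorphism ring of an abelian group on the carrier.
  record Abelian : Set (s ⊔ lsuc (c ⊔ ℓ)) where
    infixl 6 _+_
    infixl 7 _*_
    field
      ring         : Ring (c ⊔ ℓ) (c ⊔ ℓ)
      _+_          : Carrier → Carrier → Carrier
      0#           : Carrier
      -_           : Carrier → Carrier
      _*_          : Ring.Carrier ring → Carrier → Carrier
      isLeftModule : IsLeftModule ring _≈_ _+_ 0# -_ _*_
    additive : RawMonoid c ℓ
    additive = record { _≈_ = _≈_ ; _∙_ = _+_ ; ε = 0# }
    open RawMonoidDefs additive using (sum)
    field
      affine : ∀ o → Σ[ r ∈ (Fin (arity o) → Ring.Carrier ring) ] Σ[ d ∈ Carrier ]
        (∀ v → op o v ≈ sum (λ j → r j * v j) + d)

  record IsCongruence {r} (R : Rel Carrier r) : Set (s ⊔ c ⊔ ℓ ⊔ r) where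
    field
      isEquivalence : IsEquivalence R
      reflexive     : _≈_ ⇒ R
      compatible    : ∀ o {u v} → (∀ j → R (u j) (v j)) → R (op o u) (op o v)

  -- Under `Classical` every relation is equivalent to one at level ℓ, so quantifying
  -- at a single level loses no congruences.
  Simple : Set (s ⊔ c ⊔ lsuc ℓ)
  Simple = (∃[ a ] ∃[ b ] ¬ a ≈ b) ×
    (∀ (R : Rel Carrier ℓ) → IsCongruence R → (R ⇒ _≈_) ⊎ (∀ a b → R a b))

  IsSubuniverse : ∀ {p} → Pred Carrier p → Set (s ⊔ c ⊔ p)
  IsSubuniverse P = ∀ o {v} → (∀ j → v j ∈ P) → op o v ∈ P

  subalgebra : ∀ {p} {P : Pred Carrier p} → IsSubuniverse P → Algebra S (c ⊔ p) ℓ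
  subalgebra {P = P} P-sub = record
    { setoid  = record
      { Carrier       = Σ Carrier P
      ; _≈_           = λ a b → proj₁ a ≈ proj₁ b
      ; isEquivalence = record { refl = refl ; sym = sym ; trans = trans }
      }
    ; op      = λ o v → op o (proj₁ ∘ v) , P-sub o (proj₂ ∘ v)
    ; op-cong = λ o → op-cong o
    }

  IsIdempotent : Carrier → Set (s ⊔ c ⊔ ℓ)
  IsIdempotent e = IsSubuniverse (λ a → a ≈ e)

  power : ∀ {i} → Set i → Algebra S (i ⊔ c) (i ⊔ ℓ)
  power I = record
    { setoid  = record
      { Carrier       = I → Carrier
      ; _≈_           = λ f g → ∀ i → f i ≈ g i
      ; isEquivalence = record
        { refl  = λ _ → refl
        ; sym   = λ p i → sym (p i)
        ; trans = λ p q i → trans (p i) (q i)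
        }
      }
    ; op      = λ o v i → op o (λ j → v j i)
    ; op-cong = λ o p i → op-cong o (λ j → p j i)
    }

  Aut : Group (s ⊔ c ⊔ ℓ) (c ⊔ ℓ)
  Aut = subgroup (permutationGroup setoid)
    {λ f → ∀ o v → to f (op o v) ≈ op o (to f ∘ v)} record
    { ∙-closed  = λ {f} p q o v → trans (to-cong f (q o v)) (p o _)
    ; ε-closed  = λ _ _ → refl
    ; ⁻¹-closed = λ {f} p o v → inverseʳ f (sym (trans (p o _)
        (op-cong o (λ _ → inverseˡ f refl))))
    }
    where open Inverse

  infixr 8 _⟨$⟩_
  _⟨$⟩_ : Group.Carrier Aut → Carrier → Carrier
  φ ⟨$⟩ a = Inverse.to (proj₁ φ) a

  SameOrbit : Rel Carrier (s ⊔ c ⊔ ℓ)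
  SameOrbit a b = ∃[ α ] α ⟨$⟩ a ≈ b

  Fixes : Carrier → Pred (Group.Carrier Aut) ℓ
  Fixes e α = α ⟨$⟩ e ≈ e

  image : ∀ {r} → Group.Carrier Aut → Rel Carrier r → Rel Carrier (c ⊔ ℓ ⊔ r)
  image φ R a b = ∃[ a′ ] ∃[ b′ ] R a′ b′ × φ ⟨$⟩ a′ ≈ a × φ ⟨$⟩ b′ ≈ b

------------------------------------------------------------------------
-- Topology

-- A topological space presented by a base; `Open U` says that `U` is a union of
-- basic open sets.
record Space p e i k : Set (lsuc (p ⊔ e ⊔ i ⊔ k)) where
  field
    points : Setoid p e
  open Setoid points public
  field
    Base : Set i
    ⟦_⟧  : Base → Pred Carrier k

  Near : ∀ {q} → Carrier → Pred Carrier q → Set (p ⊔ i ⊔ k ⊔ q)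
  Near y U = ∃[ b ] y ∈ ⟦ b ⟧ × (∀ z → z ∈ ⟦ b ⟧ → z ∈ U)

  Open : ∀ {q} → Pred Carrier q → Set (p ⊔ i ⊔ k ⊔ q)
  Open U = ∀ y → y ∈ U → Near y U

  field
    base-resp    : ∀ b y z → y ≈ z → y ∈ ⟦ b ⟧ → z ∈ ⟦ b ⟧
    base-covers  : ∀ y → ∃[ b ] y ∈ ⟦ b ⟧
    base-refines : ∀ b c → Open (⟦ b ⟧ ∩ ⟦ c ⟧)

  near-map : ∀ {q r} {U : Pred Carrier q} {V : Pred Carrier r} y →
             (∀ z → z ∈ U → z ∈ V) → Near y U → Near y V
  near-map y f (b , y∈b , b⊆U) = b , y∈b , λ z z∈b → f z (b⊆U z z∈b)

  near-∩ : ∀ {q r} {U : Pred Carrier q} {V : Pred Carrier r} y →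
           Near y U → Near y V → Near y (U ∩ V)
  near-∩ y (b , y∈b , b⊆U) (c , y∈c , c⊆V) =
    near-map y (λ z (z∈b , z∈c) → b⊆U z z∈b , c⊆V z z∈c)
             (base-refines b c y (y∈b , y∈c))

  near-⋂ : ∀ {q m} {U : Fin m → Pred Carrier q} y →
           (∀ j → Near y (U j)) → Near y (λ z → ∀ j → z ∈ U j)
  near-⋂ {m = zero}  y _ = proj₁ (base-covers y) , proj₂ (base-covers y) , λ _ _ ()
  near-⋂ {m = suc m} y p =
    near-map y (λ { _ (q , _) zero → q ; _ (_ , q) (suc j) → q j })
             (near-∩ y (p zero) (near-⋂ y (λ j → p (suc j))))

-- The preimage condition forces `f` to respect the equalities as soon as points of
-- `Y` are separated by open sets (in particular for discrete `Y`), so `f` may be a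
-- bare function.
Continuous : ∀ {p e i k p′ e′ i′ k′} (X : Space p e i k) (Y : Space p′ e′ i′ k′) →
             (Space.Carrier X → Space.Carrier Y) →
             Set (p ⊔ i ⊔ k ⊔ p′ ⊔ i′ ⊔ lsuc k′)
Continuous {k′ = k′} X Y f = ∀ {U : Pred (Space.Carrier Y) k′} →
  Space.Open Y U → Space.Open X (U ∘ f)

discrete : ∀ {c ℓ} → Setoid c ℓ → Space c ℓ c ℓ
discrete S = record
  { points       = S
  ; Base         = Carrier
  ; ⟦_⟧          = λ a b → b ≈ a
  ; base-resp    = λ _ _ _ p q → trans (sym p) q
  ; base-covers  = λ y → y , refl
  ; base-refines = λ _ _ y (p , q) → y , refl , λ _ r → trans r p , trans r q
  }
  where open Setoid S

subspace : ∀ {p e i k q} (X : Space p e i k) → Pred (Space.Carrier X) q →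
           Space (p ⊔ q) e i k
subspace X P = record
  { points       = record
    { Carrier       = Σ Carrier P
    ; _≈_           = λ y z → proj₁ y ≈ proj₁ z
    ; isEquivalence = record { refl = refl ; sym = sym ; trans = trans }
    }
  ; Base         = Base
  ; ⟦_⟧          = λ b y → proj₁ y ∈ ⟦ b ⟧
  ; base-resp    = λ b y z → base-resp b (proj₁ y) (proj₁ z)
  ; base-covers  = λ y → base-covers (proj₁ y)
  ; base-refines = λ b c y p → let d , y∈d , d⊆ = base-refines b c (proj₁ y) p
                               in d , y∈d , λ z → d⊆ (proj₁ z)
  }
  where open Space X

Homeo : ∀ {p e i k} → Space p e i k → Group (p ⊔ e ⊔ i ⊔ lsuc k) (p ⊔ e)
Homeo X = subgroup (permutationGroup (Space.points X))
  {λ f → Continuous X X (to f) × Continuous X X (from f)} record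
  { ∙-closed  = λ (p , p′) (q , q′) →
      (λ U-open → q (p U-open)) , (λ U-open → p′ (q′ U-open))
  ; ε-closed  = (λ U-open → U-open) , (λ U-open → U-open)
  ; ⁻¹-closed = λ (p , p′) → p′ , p
  }
  where open Inverse

HomeoFixing : ∀ {p e i k n} (X : Space p e i k) → (Fin n → Space.Carrier X) →
              Group (p ⊔ e ⊔ i ⊔ lsuc k) (p ⊔ e)
HomeoFixing X xs = subgroup (Homeo X)
  {λ σ → ∀ i → Inverse.to (proj₁ σ) (xs i) ≈ xs i} record
  { ∙-closed  = λ {σ} p q i → trans (Inverse.to-cong (proj₁ σ) (q i)) (p i)
  ; ε-closed  = λ _ → refl
  ; ⁻¹-closed = λ {σ} p i → Inverse.inverseʳ (proj₁ σ) (sym (p i))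
  }
  where open Space X

module _ {p e i k c ℓ} (X : Space p e i k) (S : Setoid c ℓ) where

  private
    module X = Space X
    module S = Setoid S

  LocallyConstant : (X.Carrier → S.Carrier) → Set (p ⊔ i ⊔ k ⊔ ℓ)
  LocallyConstant f = ∀ y → X.Near y (λ z → f z S.≈ f y)

  continuous⇒locallyConstant : ∀ {f} → Continuous X (discrete S) f → LocallyConstant f
  continuous⇒locallyConstant {f} f-cont y =
    f-cont {λ a → a S.≈ f y} (λ a p → a , S.refl , λ _ q → S.trans q p) y S.refl

  locallyConstant⇒continuous : ∀ {f} → LocallyConstant f → Continuous X (discrete S) f
  locallyConstant⇒continuous {f} f-lc {U} U-open y fy∈U =
    let _ , fy∈a , a⊆U = U-open (f y) fy∈U
    in X.near-map y (λ z p → a⊆U (f z) (S.trans p fy∈a)) (f-lc y)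

  locallyConstant⇒cong : ∀ {f} → LocallyConstant f → ∀ y z → y X.≈ z → f y S.≈ f z
  locallyConstant⇒cong f-lc y z y≈z =
    let b , y∈b , b⊆ = f-lc y in S.sym (b⊆ z (X.base-resp b y z y≈z y∈b))

------------------------------------------------------------------------
-- Stone spaces and Boolean powers

module _ {b ℓb} (B : BooleanAlgebra b ℓb) where

  open BooleanAlgebra B using (Carrier; _≈_; _∧_; ⊤; ⊥)
  private module B = BooleanAlgebra B

  record IsProperFilter {u} (F : Pred Carrier u) : Set (b ⊔ ℓb ⊔ u) where
    field
      ⊤∈F    : ⊤ ∈ F
      ∧-mem  : ∀ {a c} → a ∈ F → c ∈ F → a ∧ c ∈ F
      upward : ∀ {a c} → a ∧ c ≈ a → a ∈ F → c ∈ F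
      ⊥∉F    : ⊥ ∉ F

  -- The level b ⊔ ℓb is large enough for the filter generated by an ultrafilter and
  -- an element.
  record Ultrafilter : Set (lsuc (b ⊔ ℓb)) where
    field
      set            : Pred Carrier (b ⊔ ℓb)
      isProperFilter : IsProperFilter set
      maximal        : ∀ (F : Pred Carrier (b ⊔ ℓb)) → IsProperFilter F →
                       set ⊆ F → F ⊆ set
    open IsProperFilter isProperFilter public

  open Ultrafilter

  StoneSpace : Space (lsuc (b ⊔ ℓb)) (b ⊔ ℓb) b (b ⊔ ℓb)
  StoneSpace = record
    { points       = record
      { Carrier       = Ultrafilter
      ; _≈_           = λ x y → set x ≐ set y
      ; isEquivalence = record
        { refl  = (λ p → p) , (λ p → p)
        ; sym   = λ (p , q) → q , p
        ; trans = λ (p , q) (p′ , q′) → (λ r → p′ (p r)) , (λ r → q (q′ r))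
        }
      }
    ; Base         = Carrier
    ; ⟦_⟧          = λ a x → a ∈ set x
    ; base-resp    = λ _ _ _ (x⊆y , _) → x⊆y
    ; base-covers  = λ x → ⊤ , ⊤∈F x
    ; base-refines = λ a c x (a∈x , c∈x) → a ∧ c , ∧-mem x a∈x c∈x , λ y p →
        upward y (B.trans (B.∧-cong (B.∧-comm a c) B.refl)
          (B.trans (B.∧-assoc c a a)
            (B.trans (B.∧-cong B.refl (idem a)) (B.∧-comm c a)))) p ,
        upward y (B.trans (B.∧-assoc a c c) (B.∧-cong B.refl (idem c))) p
    }
    where
    idem : ∀ a → a ∧ a ≈ a
    idem a = B.trans (B.∧-cong B.refl (B.sym (B.∨-absorbs-∧ a a))) (B.∧-absorbs-∨ a (a ∧ a))

  -- Distinct ultrafilters are separated by a basic open set.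
  stone-T₁ : Classical → ∀ x y → ¬ (set x ≐ set y) → ∃[ a ] a ∈ set x × a ∉ set y
  stone-T₁ em x y x≉y with em {P = ∃[ a ] a ∈ set x × a ∉ set y}
  ... | yes p = p
  ... | no ¬p = ⊥-elim (x≉y (x⊆y , maximal x (set y) (isProperFilter y) x⊆y))
    where
    x⊆y : set x ⊆ set y
    x⊆y {a} a∈x with em {P = a ∈ set y}
    ... | yes a∈y = a∈y
    ... | no  a∉y = ⊥-elim (¬p (a , a∈x , a∉y))

module _ {s} {S : Signature s} {a ℓa b ℓb}
         (A : Algebra S a ℓa) (B : BooleanAlgebra b ℓb) where

  private
    module A = Algebra A
    X = StoneSpace B
    module X = Space X

  booleanPower : Algebra S (a ⊔ lsuc (b ⊔ ℓb ⊔ ℓa)) (lsuc (b ⊔ ℓb) ⊔ ℓa)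
  booleanPower = subalgebra (power A X.Carrier)
    {P = Continuous X (discrete A.setoid)} λ o {v} v-cont →
      locallyConstant⇒continuous X A.setoid λ y →
        X.near-map y (λ _ p → A.op-cong o p)
          (X.near-⋂ y (λ j → continuous⇒locallyConstant X A.setoid (v-cont j) y))

  filteredBooleanPower : ∀ {n} (e : Fin n → A.Carrier) → (∀ i → IsIdempotent A (e i)) →
    (Fin n → X.Carrier) → Algebra S (a ⊔ lsuc (b ⊔ ℓb ⊔ ℓa)) (lsuc (b ⊔ ℓb) ⊔ ℓa)
  filteredBooleanPower e e-idem x = subalgebra booleanPower
    {P = λ f → ∀ i → proj₁ f (x i) A.≈ e i}
    λ o p i → e-idem i o (λ j → p j i)

------------------------------------------------------------------------
-- The automorphism group of a filtered Boolean power

module FilteredPower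
  (em : Classical)
  {s a ℓa b ℓb} {S : Signature s} (A : Algebra S a ℓa) (B : BooleanAlgebra b ℓb)
  {n} (e : Fin n → Algebra.Carrier A) (e-idem : ∀ i → IsIdempotent A (e i))
  (x : Fin n → Ultrafilter B)
  where

  private
    module A = Algebra A

  X : Space (lsuc (b ⊔ ℓb)) (b ⊔ ℓb) b (b ⊔ ℓb)
  X = StoneSpace B
  module X = Space X

  Away : Pred X.Carrier (b ⊔ ℓb)
  Away y = ∀ i → ¬ y X.≈ x i

  X° : Space (lsuc (b ⊔ ℓb)) (b ⊔ ℓb) b (b ⊔ ℓb)
  X° = subspace X Away
  module X° = Space X°

  D : Algebra S (a ⊔ lsuc (b ⊔ ℓb ⊔ ℓa)) (lsuc (b ⊔ ℓb) ⊔ ℓa)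
  D = filteredBooleanPower A B e e-idem x
  module D = Algebra D

  AutA : Group (s ⊔ a ⊔ ℓa) (a ⊔ ℓa)
  AutA = Aut A
  module AutA = Group AutA

  AutD : Group (s ⊔ a ⊔ lsuc (b ⊔ ℓb ⊔ ℓa)) (a ⊔ lsuc (b ⊔ ℓb ⊔ ℓa))
  AutD = Aut D
  module AutD = Group AutD

  HomeoX : Group (lsuc (b ⊔ ℓb)) (lsuc (b ⊔ ℓb))
  HomeoX = HomeoFixing X x
  module HomeoX = Group HomeoX

  infixr 8 _·D_ _·A_ _·°_ _·X_
  _·D_ : AutD.Carrier → D.Carrier → D.Carrier
  _·D_ = _⟨$⟩_ D

  _·A_ : AutA.Carrier → A.Carrier → A.Carrier
  _·A_ = _⟨$⟩_ A

  _·°_ : Group.Carrier (Homeo X°) → X°.Carrier → X°.Carrier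
  σ ·° y = Inverse.to (proj₁ σ) y

  _·X_ : HomeoX.Carrier → X.Carrier → X.Carrier
  σ ·X y = Inverse.to (proj₁ (proj₁ σ)) y

  π : X.Carrier → D.Carrier → A.Carrier
  π y f = proj₁ (proj₁ f) y

  θ : X.Carrier → Rel D.Carrier ℓa
  θ y f g = π y f A.≈ π y g

  -- The maps φ ↦ φ° and φ ↦ (φ_y)_{y ∈ X°}, each with its defining property and
  -- the fact that this property determines it.
  record InducedMaps : Set (s ⊔ lsuc (a ⊔ lsuc (b ⊔ ℓb ⊔ ℓa))) where
    infix 9 _° _₍_₎
    field
      _°       : AutD.Carrier → Group.Carrier (Homeo X°)
      °-spec   : ∀ φ y → image D φ (θ (proj₁ y)) ⇔ θ (proj₁ (φ ° ·° y))
      °-unique : ∀ φ y z → image D φ (θ (proj₁ y)) ⇔ θ (proj₁ z) → z X°.≈ φ ° ·° y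
      _₍_₎     : AutD.Carrier → X°.Carrier → AutA.Carrier
      ₍₎-spec   : ∀ φ y f → φ ₍ y ₎ ·A π (proj₁ y) f A.≈ π (proj₁ (φ ° ·° y)) (φ ·D f)
      ₍₎-unique : ∀ φ y α →
                  (∀ f → α ·A π (proj₁ y) f A.≈ π (proj₁ (φ ° ·° y)) (φ ·D f)) →
                  α AutA.≈ φ ₍ y ₎

    bar : AutD.Carrier → X.Carrier → X.Carrier
    bar φ y with em {P = ∃[ i ] y X.≈ x i}
    ... | yes _  = y
    ... | no ¬xᵢ = proj₁ (φ ° ·° (y , λ i y≈xᵢ → ¬xᵢ (i , y≈xᵢ)))

  -- ψ⁻¹((Aut A)_{eᵢ}) ∪ {xᵢ}
  stabSet : (X°.Carrier → AutA.Carrier) → Fin n → Pred X.Carrier (b ⊔ ℓb ⊔ ℓa)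
  stabSet ψ i y = (Σ[ y∈X° ∈ Away y ] Fixes A (e i) (ψ (y , y∈X°))) ⊎ y X.≈ x i

  record InK (ψ : X°.Carrier → AutA.Carrier) : Set (s ⊔ lsuc (a ⊔ b ⊔ ℓb ⊔ ℓa)) where
    field
      continuous : Continuous X° (discrete AutA.setoid) ψ
      open-stab  : ∀ i → X.Open (stabSet ψ i)

  private

    separate : ∀ y → X.Near y (λ z → ∀ i → z X.≈ x i → y X.≈ x i)
    separate y = X.near-⋂ y separateᵢ
      where
      separateᵢ : ∀ i → X.Near y (λ z → z X.≈ x i → y X.≈ x i)
      separateᵢ i with em {P = y X.≈ x i}
      ... | yes y≈xᵢ = let c , y∈c = X.base-covers y in c , y∈c , λ _ _ _ → y≈xᵢ
      ... | no  y≉xᵢ = let c , y∈c , xᵢ∉c = stone-T₁ B em y (x i) y≉xᵢ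
                       in c , y∈c , λ z z∈c z≈xᵢ →
                          ⊥-elim (xᵢ∉c (X.base-resp c z (x i) z≈xᵢ z∈c))

    LC : (X°.Carrier → AutA.Carrier) → Set (lsuc (b ⊔ ℓb) ⊔ a ⊔ ℓa)
    LC = LocallyConstant X° AutA.setoid

    toLC : ∀ {ψ} → InK ψ → LC ψ
    toLC ψ∈K = continuous⇒locallyConstant X° AutA.setoid (InK.continuous ψ∈K)

    mkInK : ∀ {ψ} → LC ψ → (∀ i y → y X.≈ x i → X.Near y (stabSet ψ i)) → InK ψ
    mkInK {ψ} ψ-lc at-xᵢ = record
      { continuous = locallyConstant⇒continuous X° AutA.setoid ψ-lc
      ; open-stab  = open-stab
      }
      where
      open-stab : ∀ i → X.Open (stabSet ψ i)
      open-stab i y (inj₂ y≈xᵢ) = at-xᵢ i y y≈xᵢ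
      open-stab i y (inj₁ (y∈X° , fixes)) =
        let c , y∈c , const = ψ-lc (y , y∈X°)
        in X.near-map y
          (λ z (sep , z∈c) → let z∈X° = λ j z≈xⱼ → y∈X° j (sep j z≈xⱼ) in
            inj₁ (z∈X° , A.trans (const (z , z∈X°) z∈c (e i)) fixes))
          (X.near-∩ y (separate y) (c , y∈c , λ _ z∈c → z∈c))

    InK-isSubgroup : IsSubgroup (Pointwise.group X°.Carrier AutA) InK
    InK-isSubgroup = record
      { ∙-closed = λ {ψ} {χ} ψ∈K χ∈K → mkInK
          (λ y → X°.near-map y
            (λ z (p , q) → AutA.∙-cong {ψ z} {ψ y} {χ z} {χ y} p q)
            (X°.near-∩ y (toLC ψ∈K y) (toLC χ∈K y)))
          (λ i y y≈xᵢ → X.near-map y (λ z (p , q) → ∙-stab {ψ} {χ} ψ∈K i z p q)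
            (X.near-∩ y (InK.open-stab ψ∈K i y (inj₂ y≈xᵢ))
                      (InK.open-stab χ∈K i y (inj₂ y≈xᵢ))))
      ; ε-closed = mkInK
          (λ y → let d , y∈d = X°.base-covers y in d , y∈d , λ _ _ _ → A.refl)
          (λ i y y≈xᵢ → X.near-map y (λ z → ε-stab i y z y≈xᵢ) (separate y))
      ; ⁻¹-closed = λ {ψ} ψ∈K → mkInK
          (λ y → X°.near-map y (λ z → AutA.⁻¹-cong {ψ z} {ψ y}) (toLC ψ∈K y))
          (λ i y y≈xᵢ → X.near-map y (⁻¹-stab ψ i)
            (InK.open-stab ψ∈K i y (inj₂ y≈xᵢ)))
      }
      where
      ∙-stab : ∀ {ψ χ} → InK ψ → ∀ i z → z ∈ stabSet ψ i → z ∈ stabSet χ i →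
               z ∈ stabSet (λ y → ψ y AutA.∙ χ y) i
      ∙-stab _ i z (inj₂ r) _        = inj₂ r
      ∙-stab _ i z (inj₁ _) (inj₂ r) = inj₂ r
      ∙-stab {ψ} ψ∈K i z (inj₁ (z∈ , r)) (inj₁ (z∈′ , r′)) = inj₁ (z∈′ , A.trans
        (Inverse.to-cong (proj₁ (ψ (z , z∈′))) r′)
        (A.trans (locallyConstant⇒cong X° AutA.setoid {ψ} (toLC ψ∈K)
                   (z , z∈′) (z , z∈) (X.refl {z}) (e i)) r))

      ε-stab : ∀ i y z → y X.≈ x i → (∀ j → z X.≈ x j → y X.≈ x j) →
               z ∈ stabSet (λ _ → AutA.ε) i
      ε-stab i y z y≈xᵢ sep with em {P = ∃[ j ] z X.≈ x j}
      ... | no ¬xⱼ = inj₁ ((λ j z≈xⱼ → ¬xⱼ (j , z≈xⱼ)) , A.refl)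
      ... | yes (j , z≈xⱼ) = inj₂ (X.trans {z} {y} {x i}
        (X.trans {z} {x j} {y} z≈xⱼ (X.sym {y} {x j} (sep j z≈xⱼ))) y≈xᵢ)

      ⁻¹-stab : ∀ ψ i z → z ∈ stabSet ψ i → z ∈ stabSet (λ y → ψ y AutA.⁻¹) i
      ⁻¹-stab ψ i z (inj₂ r)        = inj₂ r
      ⁻¹-stab ψ i z (inj₁ (z∈ , r)) =
        inj₁ (z∈ , Inverse.inverseʳ (proj₁ (ψ (z , z∈))) (A.sym r))

  K : Group (s ⊔ lsuc (a ⊔ b ⊔ ℓb ⊔ ℓa)) (lsuc (b ⊔ ℓb) ⊔ a ⊔ ℓa)
  K = subgroup (Pointwise.group X°.Carrier AutA) InK-isSubgroup

{-# OPTIONS --safe #-}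

-- Let q : D → A be a surjective homomorphism.  The clopen sets c such that elements of D
-- agreeing on c have the same image under q form an ultrafilter z.  It is prime because
-- otherwise, A being simple, every pair of elements of A lifts along q both to a pair
-- agreeing on c and to a pair agreeing off c; for such pairs an identity in the Mal'cev
-- term m, checked on c and off c separately, shows that m commutes with all operations of A,
-- and then A is affine.  Simplicity of A turns this into q = α π_z for some α ∈ Aut A and
-- z ∈ X°.  For q = π_y φ⁻¹ this yields φ°(y) = z and φ_y = α⁻¹.  Continuity of φ° and of φ_*
-- is read off from elements of D which agree or take prescribed values on suitable clopen
-- sets.  The map h is split by σ ↦ (f ↦ f σ⁻¹), and p is inverted by letting ψ ∈ K act
-- pointwise on X°.
module Submission where

open import Defs
open import Level using (Level; _⊔_)
open import Algebra.Bundles using (AbelianGroup; CommutativeMonoid; Group; Ring)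
open import Algebra.Definitions.RawMonoid using (sum)
open import Algebra.Lattice.Bundles using (BooleanAlgebra)
import Algebra.Lattice.Properties.BooleanAlgebra as BooleanAlgebraProperties
open import Algebra.Module.Structures using (IsLeftModule)
open import Algebra.Morphism.Bundles using (GroupHomomorphism)
open import Algebra.Morphism.Structures using (module GroupMorphisms)
import Algebra.Properties.AbelianGroup as AbelianGroupProperties
import Algebra.Properties.CommutativeSemigroup as CommutativeSemigroupProperties
import Algebra.Properties.Group as GroupProperties
open import Data.Bool.Base using (if_then_else_)
open import Data.Empty using (⊥-elim)
open import Data.Fin.Base using (Fin; zero; suc)
open import Data.Nat.Base using (zero; suc)
open import Data.Product using (Σ-syntax; ∃-syntax; _×_; _,_; proj₁; proj₂)
open import Data.Sum.Base using (_⊎_; inj₁; inj₂; [_,_]′; map)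
open import Function.Base using (_∘_)
open import Function.Bundles using (Inverse)
open import Relation.Binary.Bundles using (Setoid)
open import Relation.Binary.PropositionalEquality.Core as ≡ using (_≡_)
import Relation.Binary.Reasoning.Setoid as SetoidReasoning
open import Relation.Nullary.Decidable.Core
  using (Dec; yes; no; does; True; toWitness; fromWitness)
open import Relation.Nullary.Negation.Core using (¬_)
open import Relation.Unary using (Pred; _∈_; _∉_)

-- Abelian Mal'cev algebras

-- The obstacle is the special points. All elements of `D` agree at `x i`, so `θ (x i)` is full and
-- says nothing about where `φ` sends nearby points; a priori they could be moved towards `x j`. The
-- automorphisms `φ_y` exclude this: every element of `D` is `e i` near `x i` and `e j` near `x j`,
-- so for such `y` the automorphism `φ_y` would carry `e i` to `e j`, against the assumption on
-- orbits. The same observation with `i = j` explains the condition that defines `K`. Moreover,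
-- constant functions need not belong to `D`, so test elements are patched to be `e i` near `x i`,
-- and in the study of a point of `X°` the patches are chosen to miss it. The Mal'cev term does
-- double duty: besides the identity behind affineness, it makes the image under `q` of the
-- congruence "agreeing on `c`" transitive, so that simplicity applies to that image. Finiteness of
-- `A` makes an automorphism of `A` a matter of finitely many values, each locally constant in `y`.

module EndomorphismRing {c ℓ} (M : AbelianGroup c ℓ) where

  open AbelianGroup M
  open AbelianGroupProperties M using (identityˡ-unique; ⁻¹-∙-comm)
  open CommutativeSemigroupProperties commutativeSemigroup using (interchange)

  record Endo : Set (c ⊔ ℓ) where
    field
      fun  : Carrier → Carrier
      cong : ∀ {x y} → x ≈ y → fun x ≈ fun y
      homo : ∀ x y → fun (x ∙ y) ≈ fun x ∙ fun y

    homo-ε : fun ε ≈ ε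
    homo-ε = identityˡ-unique _ _ (trans (sym (homo ε ε)) (cong (identityˡ ε)))

  open Endo public

  endoRing : Ring (c ⊔ ℓ) (c ⊔ ℓ)
  endoRing = record
    { Carrier = Endo
    ; _≈_ = λ r s → ∀ x → fun r x ≈ fun s x
    ; _+_ = λ r s → record
      { fun  = λ x → fun r x ∙ fun s x
      ; cong = λ p → ∙-cong (cong r p) (cong s p)
      ; homo = λ x y → trans (∙-cong (homo r x y) (homo s x y)) (interchange _ _ _ _)
      }
    ; _*_ = λ r s → record
      { fun  = fun r ∘ fun s
      ; cong = cong r ∘ cong s
      ; homo = λ x y → trans (cong r (homo s x y)) (homo r _ _)
      }
    ; -_ = λ r → record
      { fun  = λ x → fun r x ⁻¹
      ; cong = ⁻¹-cong ∘ cong r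
      ; homo = λ x y → trans (⁻¹-cong (homo r x y)) (sym (⁻¹-∙-comm _ _))
      }
    ; 0# = record { fun = λ _ → ε ; cong = λ _ → refl ; homo = λ _ _ → sym (identityˡ ε) }
    ; 1# = record { fun = λ x → x ; cong = λ p → p ; homo = λ _ _ → refl }
    ; isRing = record
      { +-isAbelianGroup = record
        { isGroup = record
          { isMonoid = record
            { isSemigroup = record
              { isMagma = record
                { isEquivalence = record
                  { refl  = λ _ → refl
                  ; sym   = λ p x → sym (p x)
                  ; trans = λ p q x → trans (p x) (q x)
                  }
                ; ∙-cong = λ p q x → ∙-cong (p x) (q x)
                }
              ; assoc = λ r s t x → assoc _ _ _
              }
            ; identity = (λ r x → identityˡ _) , (λ r x → identityʳ _)
            }
          ; inverse = (λ r x → inverseˡ _) , (λ r x → inverseʳ _)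
          ; ⁻¹-cong = λ p x → ⁻¹-cong (p x)
          }
        ; comm = λ r s x → comm _ _
        }
      ; *-cong = λ {r} {r′} {s} {s′} p q x → trans (cong r (q x)) (p (fun s′ x))
      ; *-assoc = λ r s t x → refl
      ; *-identity = (λ r x → refl) , (λ r x → refl)
      ; distrib = (λ r s t x → homo r _ _) , (λ r s t x → refl)
      }
    }

  endoModule : IsLeftModule endoRing _≈_ _∙_ ε _⁻¹ fun
  endoModule = record
    { isLeftSemimodule = record
      { +ᴹ-isCommutativeMonoid = isCommutativeMonoid
      ; isPreleftSemimodule = record
        { *ₗ-cong      = λ {r} {s} {x} {y} p q → trans (cong r q) (p y)
        ; *ₗ-zeroˡ     = λ _ → refl
        ; *ₗ-distribʳ  = λ _ _ _ → refl
        ; *ₗ-identityˡ = λ _ → refl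
        ; *ₗ-assoc     = λ _ _ _ → refl
        ; *ₗ-zeroʳ     = homo-ε
        ; *ₗ-distribˡ  = homo
        }
      }
    ; -ᴹ‿cong   = ⁻¹-cong
    ; -ᴹ‿inverse = inverse
    }

  -- An additive map on a finite power is the sum of its restrictions to the coordinate axes; the
  -- induction splits a tuple into its head padded by `ε` and `ε` followed by its tail.
  additive⇒linear : ∀ k (g : (Fin k → Carrier) → Carrier) →
    (∀ {u v} → (∀ j → u j ≈ v j) → g u ≈ g v) →
    (∀ u v → g (λ j → u j ∙ v j) ≈ g u ∙ g v) →
    Σ[ r ∈ (Fin k → Endo) ] (∀ v → g v ≈ sum rawMonoid (λ j → fun (r j) (v j)))
  additive⇒linear zero g g-cong g-homo = (λ ()) , λ v →
    -- The empty tuple equals its own double, so `g v` is idempotent and therefore `ε`.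
    identityˡ-unique _ _ (trans (sym (g-homo v v)) (g-cong λ ()))
  additive⇒linear (suc k) g g-cong g-homo =
    let r , r-spec = additive⇒linear k (λ v → g (ε ◂ v))
          (λ p → g-cong λ { zero → refl ; (suc j) → p j })
          (λ u v → trans (g-cong λ { zero → sym (identityˡ ε) ; (suc j) → refl })
                         (g-homo (ε ◂ u) (ε ◂ v)))
    in head-endo ◂′ r , λ v → trans
      (trans (g-cong λ { zero → sym (identityʳ _) ; (suc j) → sym (identityˡ _) })
             (g-homo (v zero ◂ λ _ → ε) (ε ◂ (v ∘ suc))))
      (∙-congˡ (r-spec (v ∘ suc)))
    where
    infixr 5 _◂_ _◂′_
    _◂_ : Carrier → (Fin k → Carrier) → Fin (suc k) → Carrier
    (a ◂ v) zero    = a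
    (a ◂ v) (suc j) = v j

    _◂′_ : Endo → (Fin k → Endo) → Fin (suc k) → Endo
    (a ◂′ v) zero    = a
    (a ◂′ v) (suc j) = v j

    head-endo : Endo
    head-endo = record
      { fun  = λ a → g (a ◂ λ _ → ε)
      ; cong = λ p → g-cong λ { zero → p ; (suc j) → refl }
      ; homo = λ a b → trans (g-cong λ { zero → refl ; (suc j) → sym (identityˡ ε) })
                             (g-homo (a ◂ λ _ → ε) (b ◂ λ _ → ε))
      }

module _ {s} {S : Signature s} {c ℓ} (A : Algebra S c ℓ) where

  open Algebra A

  eval-cong : ∀ {V} (t : Term S V) {ρ ρ′ : V → Carrier} → (∀ v → ρ v ≈ ρ′ v) →
              eval A t ρ ≈ eval A t ρ′
  eval-cong (var v)    p = p v
  eval-cong (app o ts) p = op-cong o (λ j → eval-cong (ts j) p)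

  ternary : Term S (Fin 3) → Carrier → Carrier → Carrier → Carrier
  ternary t a b d = eval A t (⟨_,_,_⟩ A a b d)

  ternary-cong : (t : Term S (Fin 3)) → ∀ {a a′ b b′ d d′} → a ≈ a′ → b ≈ b′ → d ≈ d′ →
                 ternary t a b d ≈ ternary t a′ b′ d′
  ternary-cong t p q r =
    eval-cong t λ { zero → p ; (suc zero) → q ; (suc (suc zero)) → r }

-- If the Mal'cev term `m` commutes with the basic operations, it commutes with
-- itself, so that `m(x,0,y)` is an abelian group operation and `m(x,z,y) = x - z + y`.
-- A basic operation commuting with `m` is then additive up to a constant.
module CommutingMal'cev
  {s} {S : Signature s} {c ℓ} (A : Algebra S c ℓ) (mal : Mal'cev A)
  (commutes : ∀ o x z y → Algebra._≈_ A
    (ternary A (proj₁ mal) (Algebra.op A o x) (Algebra.op A o z) (Algebra.op A o y))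
    (Algebra.op A o (λ j → ternary A (proj₁ mal) (x j) (z j) (y j))))
  (0# : Algebra.Carrier A)
  where

  open Algebra A
  open SetoidReasoning setoid

  private
    m = proj₁ mal
    M = ternary A m

  M-cong : ∀ {a a′ b b′ d d′} → a ≈ a′ → b ≈ b′ → d ≈ d′ → M a b d ≈ M a′ b′ d′
  M-cong = ternary-cong A m

  commutes-eval : ∀ {V} (t : Term S V) x z y →
    M (eval A t x) (eval A t z) (eval A t y) ≈ eval A t (λ j → M (x j) (z j) (y j))
  commutes-eval (var v)    x z y = refl
  commutes-eval (app o ts) x z y = trans (commutes o _ _ _)
    (op-cong o (λ j → commutes-eval (ts j) x z y))

  -- This is `commutes-eval` for `m` itself. Each group law below comes from one 3 by 3 matrix
  -- padded with `0#`, read once by rows and once by columns.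
  transpose : ∀ a₁ a₂ a₃ b₁ b₂ b₃ d₁ d₂ d₃ →
    M (M a₁ a₂ a₃) (M b₁ b₂ b₃) (M d₁ d₂ d₃) ≈
    M (M a₁ b₁ d₁) (M a₂ b₂ d₂) (M a₃ b₃ d₃)
  transpose a₁ a₂ a₃ b₁ b₂ b₃ d₁ d₂ d₃ = trans
    (commutes-eval m (⟨_,_,_⟩ A a₁ a₂ a₃) (⟨_,_,_⟩ A b₁ b₂ b₃) (⟨_,_,_⟩ A d₁ d₂ d₃))
    (eval-cong A m λ { zero → refl ; (suc zero) → refl ; (suc (suc zero)) → refl })

  Mˡ : ∀ {a b} → M a a b ≈ b
  Mˡ = proj₁ (proj₂ mal _ _)

  Mʳ : ∀ {a b} → M b a a ≈ b
  Mʳ = proj₂ (proj₂ mal _ _)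

  infixl 6 _+_
  _+_ : Carrier → Carrier → Carrier
  x + y = M x 0# y

  -_ : Carrier → Carrier
  - x = M 0# x 0#

  +-neg : ∀ x y → x + - y ≈ M x y 0#
  +-neg x y = begin
    M x 0# (M 0# y 0#)                          ≈⟨ M-cong Mʳ Mˡ refl ⟨
    M (M x 0# 0#) (M 0# 0# 0#) (M 0# y 0#)      ≈⟨ transpose _ _ _ _ _ _ _ _ _ ⟩
    M (M x 0# 0#) (M 0# 0# y) (M 0# 0# 0#)      ≈⟨ M-cong Mʳ Mˡ Mˡ ⟩
    M x y 0#                                    ∎

  M-as-sum : ∀ x y z → M x y z ≈ x + - y + z
  M-as-sum x y z = begin
    M x y z                                     ≈⟨ M-cong Mʳ Mʳ Mˡ ⟨
    M (M x 0# 0#) (M y 0# 0#) (M 0# 0# z)       ≈⟨ transpose _ _ _ _ _ _ _ _ _ ⟩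
    M (M x y 0#) (M 0# 0# 0#) (M 0# 0# z)       ≈⟨ M-cong (sym (+-neg x y)) Mˡ Mˡ ⟩
    x + - y + z                                 ∎

  +-comm : ∀ x y → x + y ≈ y + x
  +-comm x y = begin
    M x 0# y                                    ≈⟨ M-cong Mˡ Mˡ Mʳ ⟨
    M (M 0# 0# x) (M 0# 0# 0#) (M y 0# 0#)      ≈⟨ transpose _ _ _ _ _ _ _ _ _ ⟩
    M (M 0# 0# y) (M 0# 0# 0#) (M x 0# 0#)      ≈⟨ M-cong Mˡ Mˡ Mʳ ⟩
    M y 0# x                                    ∎

  +-assoc : ∀ x y z → (x + y) + z ≈ x + (y + z)
  +-assoc x y z = begin
    M (M x 0# y) 0# z                           ≈⟨ M-cong refl Mˡ Mˡ ⟨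
    M (M x 0# y) (M 0# 0# 0#) (M 0# 0# z)       ≈⟨ transpose _ _ _ _ _ _ _ _ _ ⟩
    M (M x 0# 0#) (M 0# 0# 0#) (M y 0# z)       ≈⟨ M-cong Mʳ Mˡ refl ⟩
    M x 0# (M y 0# z)                           ∎

  -‿inverseʳ : ∀ x → x + - x ≈ 0#
  -‿inverseʳ x = trans (+-neg x x) Mˡ

  +-abelianGroup : AbelianGroup c ℓ
  +-abelianGroup = record
    { isAbelianGroup = record
      { isGroup = record
        { isMonoid = record
          { isSemigroup = record
            { isMagma = record
              { isEquivalence = isEquivalence
              ; ∙-cong        = λ p q → M-cong p refl q
              }
            ; assoc = +-assoc
            }
          ; identity = (λ _ → Mˡ) , (λ _ → Mʳ)
          }
        ; inverse = (λ x → trans (+-comm (- x) x) (-‿inverseʳ x)) , -‿inverseʳ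
        ; ⁻¹-cong = λ p → M-cong refl p refl
        }
      ; comm = +-comm
      }
    }

  open EndomorphismRing +-abelianGroup
  private module G = AbelianGroup +-abelianGroup

  -- Since `u + v` is `m` with the zero tuple in the middle, commutation with `o` puts `d` in the
  -- middle, and `M-as-sum` turns this into a subtraction of `d`.
  op-linear-part : ∀ o u v → let d = op o (λ _ → 0#) in
    op o (λ j → u j + v j) + - d ≈ (op o u + - d) + (op o v + - d)
  op-linear-part o u v = begin
    op o (λ j → u j + v j) + - d      ≈⟨ G.∙-congʳ (commutes o u (λ _ → 0#) v) ⟨
    M (op o u) d (op o v) + - d       ≈⟨ G.∙-congʳ (M-as-sum _ _ _) ⟩
    op o u + - d + op o v + - d       ≈⟨ +-assoc _ _ _ ⟩
    (op o u + - d) + (op o v + - d)   ∎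
    where d = op o (λ _ → 0#)

  abelian : Abelian A
  abelian = record
    { ring         = endoRing
    ; isLeftModule = endoModule
    ; affine       = λ o →
        let d = op o (λ _ → 0#)
            r , r-spec = additive⇒linear _ (λ v → op o v + - d)
              (λ p → G.∙-congʳ (op-cong o p)) (op-linear-part o)
        in r , d , λ v → begin
          op o v                 ≈⟨ G.identityʳ _ ⟨
          op o v + 0#            ≈⟨ G.∙-congˡ (G.inverseˡ d) ⟨
          op o v + (- d + d)     ≈⟨ +-assoc _ _ _ ⟨
          op o v + - d + d       ≈⟨ G.∙-congʳ (r-spec v) ⟩
          sum G.rawMonoid (λ j → fun (r j) (v j)) + d ∎
    }

module _ {s} {S : Signature s} {c ℓ c′ ℓ′} (A : Algebra S c ℓ) (A′ : Algebra S c′ ℓ′)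
  (h : Algebra.Carrier A → Algebra.Carrier A′)
  (h-op : ∀ o v → Algebra._≈_ A′ (h (Algebra.op A o v)) (Algebra.op A′ o (h ∘ v)))
  where

  private module A′ = Algebra A′

  eval-homo : ∀ {V} (t : Term S V) ρ → h (eval A t ρ) A′.≈ eval A′ t (h ∘ ρ)
  eval-homo (var v)    ρ = A′.refl
  eval-homo (app o ts) ρ = A′.trans (h-op o _) (A′.op-cong o (λ j → eval-homo (ts j) ρ))

  ternary-homo : ∀ (t : Term S (Fin 3)) u v w →
    h (ternary A t u v w) A′.≈ ternary A′ t (h u) (h v) (h w)
  ternary-homo t u v w = A′.trans (eval-homo t _)
    (eval-cong A′ t λ { zero → A′.refl ; (suc zero) → A′.refl ; (suc (suc zero)) → A′.refl })

-- Ultrafilters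

-- `Simple` and `Ultrafilter` quantify over relations and filters at fixed levels, which
-- are below those of the relations and filters used here.
module Resizing (em : Classical) where

  -- `True` of a decision is a unit or an empty type at the lowest level, so it fits into any level
  -- `q`.
  record Resize {p} q (P : Set p) : Set q where
    constructor resized
    field
      holds : True (em {P = P})

  resize : ∀ {p q} {P : Set p} → P → Resize q P
  resize p = resized (fromWitness p)

  unresize : ∀ {p q} {P : Set p} → Resize q P → P
  unresize (resized t) = toWitness t

  by-contradiction : ∀ {p} {P : Set p} → ¬ ¬ P → P
  by-contradiction {P = P} ¬¬p with em {P = P}
  ... | yes p = p
  ... | no ¬p = ⊥-elim (¬¬p ¬p)

module Ultrafilters (em : Classical) {b ℓb} (B : BooleanAlgebra b ℓb) where

  open BooleanAlgebra B renaming (¬_ to infix 8 ∁_)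
  open BooleanAlgebraProperties B
    using (∧-⊤-isCommutativeMonoid; ∧-zeroʳ; ∧-identityʳ; ∨-identityˡ)
  open Resizing em
  open Ultrafilter
  private
    ∧-commutativeMonoid : CommutativeMonoid b ℓb
    ∧-commutativeMonoid = record { isCommutativeMonoid = ∧-⊤-isCommutativeMonoid }
  open CommutativeSemigroupProperties
    (CommutativeMonoid.commutativeSemigroup ∧-commutativeMonoid) using (interchange)

  ∧-idem : ∀ c → c ∧ c ≈ c
  ∧-idem c = trans (∧-congˡ (sym (∨-absorbs-∧ c c))) (∧-absorbs-∨ c (c ∧ c))

  ∧-lowerʳ : ∀ c d → (c ∧ d) ∧ d ≈ c ∧ d
  ∧-lowerʳ c d = trans (∧-assoc c d d) (∧-congˡ (∧-idem d))

  ∧-lowerˡ : ∀ c d → (c ∧ d) ∧ c ≈ c ∧ d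
  ∧-lowerˡ c d = trans (∧-congʳ (∧-comm c d)) (trans (∧-lowerʳ d c) (∧-comm d c))

  ∁-∉ : ∀ {u} {F : Pred Carrier u} → IsProperFilter B F → ∀ {c} → c ∈ F → ∁ c ∉ F
  ∁-∉ F-proper {c} c∈F ∁c∈F =
    F.⊥∉F (F.upward (trans (∧-zeroʳ _) (sym (∧-complementʳ c))) (F.∧-mem c∈F ∁c∈F))
    where module F = IsProperFilter F-proper

  prime⇒ultrafilter : (F : Pred Carrier (b ⊔ ℓb)) → IsProperFilter B F →
                      (∀ c → c ∈ F ⊎ ∁ c ∈ F) → Ultrafilter B
  prime⇒ultrafilter F F-proper prime = record
    { set            = F
    ; isProperFilter = F-proper
    ; maximal        = λ G G-proper F⊆G {c} c∈G →
        [ (λ c∈F → c∈F) , (λ ∁c∈F → ⊥-elim (∁-∉ G-proper c∈G (F⊆G ∁c∈F))) ]′ (prime c)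
    }

  -- If `∁ c ∉ y`, then `y` and `c` generate a proper filter, so `c ∈ y` by maximality.
  ∁-mem : ∀ (y : Ultrafilter B) {c} → c ∉ set y → ∁ c ∈ set y
  ∁-mem y {c} c∉y = by-contradiction λ ∁c∉y →
    c∉y (maximal y F (F-proper ∁c∉y)
      (λ {d} d∈y → resize (d , d∈y , ∧-lowerˡ d c))
      (resize (⊤ , ⊤∈F y , ∧-lowerʳ ⊤ c)))
    where
    F : Pred Carrier (b ⊔ ℓb)
    F d = Resize (b ⊔ ℓb) (∃[ a ] a ∈ set y × (a ∧ c) ∧ d ≈ a ∧ c)

    ∧-∧-distrib : ∀ a a′ → (a ∧ a′) ∧ c ≈ (a ∧ c) ∧ (a′ ∧ c)
    ∧-∧-distrib a a′ = trans (∧-congˡ (sym (∧-idem c))) (interchange _ _ _ _)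

    F-∧ : ∀ {a a′ d d′} → (a ∧ c) ∧ d ≈ a ∧ c → (a′ ∧ c) ∧ d′ ≈ a′ ∧ c →
          ((a ∧ a′) ∧ c) ∧ (d ∧ d′) ≈ (a ∧ a′) ∧ c
    F-∧ {a} {a′} {d} {d′} p q = begin
      ((a ∧ a′) ∧ c) ∧ (d ∧ d′)         ≈⟨ ∧-congʳ (∧-∧-distrib a a′) ⟩
      ((a ∧ c) ∧ (a′ ∧ c)) ∧ (d ∧ d′)   ≈⟨ interchange _ _ _ _ ⟩
      ((a ∧ c) ∧ d) ∧ ((a′ ∧ c) ∧ d′)   ≈⟨ ∧-cong p q ⟩
      (a ∧ c) ∧ (a′ ∧ c)                ≈⟨ ∧-∧-distrib a a′ ⟨
      (a ∧ a′) ∧ c                      ∎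
      where open SetoidReasoning setoid

    below-∁ : ∀ {a} → a ∧ c ≈ ⊥ → a ∧ ∁ c ≈ a
    below-∁ {a} a∧c≈⊥ = begin
      a ∧ ∁ c             ≈⟨ ∨-identityˡ _ ⟨
      ⊥ ∨ a ∧ ∁ c         ≈⟨ ∨-congʳ a∧c≈⊥ ⟨
      a ∧ c ∨ a ∧ ∁ c     ≈⟨ ∧-distribˡ-∨ a c (∁ c) ⟨
      a ∧ (c ∨ ∁ c)       ≈⟨ ∧-congˡ (∨-complementʳ c) ⟩
      a ∧ ⊤               ≈⟨ ∧-identityʳ a ⟩
      a                   ∎
      where open SetoidReasoning setoid

    F-proper : ∁ c ∉ set y → IsProperFilter B F
    F-proper ∁c∉y = record
      { ⊤∈F    = resize (⊤ , ⊤∈F y , ∧-identityʳ _)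
      ; ∧-mem  = λ p q →
          let a , a∈y , a≤ = unresize p
              a′ , a′∈y , a′≤ = unresize q
          in resize (a ∧ a′ , ∧-mem y a∈y a′∈y , F-∧ a≤ a′≤)
      ; upward = λ d≤d′ p → let a , a∈y , a≤ = unresize p in
          resize (a , a∈y , trans (∧-congʳ (sym a≤))
            (trans (∧-assoc _ _ _) (trans (∧-congˡ d≤d′) a≤)))
      -- If `⊥` lies above `a ∧ c`, then `a` lies below `∁ c`, which puts `∁ c` into `y`.
      ; ⊥∉F    = λ p → let a , a∈y , a≤ = unresize p in
          ∁c∉y (upward y (below-∁ (trans (sym a≤) (∧-zeroʳ _))) a∈y)
      }

-- Points and neighbourhoods in a Stone space

module StonePoints (em : Classical) {b ℓb} (B : BooleanAlgebra b ℓb)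
  {n} (x : Fin n → Ultrafilter B)
  (x-distinct : ∀ i j → Space._≈_ (StoneSpace B) (x i) (x j) → i ≡ j)
  where

  open BooleanAlgebra B using () renaming (Carrier to Clopen; ¬_ to infix 8 ∁_)
  open Resizing em
  open Ultrafilters em B
  open Ultrafilter using (isProperFilter)
  private
    X = StoneSpace B
    module X = Space X

  infix 4 _∋_ _∌_ _∋?_
  _∋_ _∌_ : X.Carrier → Clopen → Set (b ⊔ ℓb)
  y ∋ c = c ∈ Ultrafilter.set y
  y ∌ c = c ∉ Ultrafilter.set y

  _∋?_ : ∀ y c → y ∋ c ⊎ y ∌ c
  y ∋? c with em {P = y ∋ c}
  ... | yes y∋c = inj₁ y∋c
  ... | no  y∌c = inj₂ y∌c

  abstract

    near-in : ∀ {y c} → y ∋ c → X.Near y (λ z → z ∋ c)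
    near-in y∋c = _ , y∋c , λ _ p → p

    near-out : ∀ {y c} → y ∌ c → X.Near y (λ z → z ∌ c)
    near-out {y} {c} y∌c = ∁ c , ∁-mem y y∌c , λ z z∋∁c z∋c →
      ∁-∉ (isProperFilter z) z∋c z∋∁c

    near-everywhere : ∀ {q} {P : Pred X.Carrier q} y → (∀ z → z ∈ P) → X.Near y P
    near-everywhere y p = let c , y∋c = X.base-covers y in c , y∋c , λ z _ → p z

    near-≉ : ∀ y z → ¬ y X.≈ z → X.Near y (λ w → ¬ w X.≈ z)
    near-≉ y z y≉z = let c , y∋c , z∌c = stone-T₁ B em y z y≉z
      in c , y∋c , λ w w∋c w≈z → z∌c (X.base-resp c w z w≈z w∋c)

  Away : Pred X.Carrier (b ⊔ ℓb)
  Away y = ∀ i → ¬ y X.≈ x i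

  abstract

    away-open : X.Open Away
    away-open y y-away = X.near-⋂ y (λ i → near-≉ y (x i) (y-away i))

  by-location : ∀ {p} {P : Set p} y → (∀ i → y X.≈ x i → P) → (Away y → P) → P
  by-location y at away with em {P = ∃[ i ] y X.≈ x i}
  ... | yes (i , y≈xᵢ) = at i y≈xᵢ
  ... | no ¬at         = away λ i y≈xᵢ → ¬at (i , y≈xᵢ)

  abstract

    isolated : ∀ i → X.Near (x i) (λ z → ∀ j → z X.≈ x j → i ≡ j)
    isolated i = X.near-⋂ (x i) isolatedⱼ
      where
      isolatedⱼ : ∀ j → X.Near (x i) (λ z → z X.≈ x j → i ≡ j)
      isolatedⱼ j with em {P = x i X.≈ x j}
      ... | yes xᵢ≈xⱼ = near-everywhere (x i) λ _ _ → x-distinct i j xᵢ≈xⱼ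
      ... | no  xᵢ≉xⱼ = X.near-map (x i) (λ _ z≉xⱼ z≈xⱼ → ⊥-elim (z≉xⱼ z≈xⱼ))
        (near-≉ (x i) (x j) xᵢ≉xⱼ)

    near-resp : ∀ {q} {P : Pred X.Carrier q} {y z} → y X.≈ z → X.Near y P → X.Near z P
    near-resp {y = y} {z} y≈z (c , y∋c , c⊆P) = c , X.base-resp c y z y≈z y∋c , c⊆P

  -- On `nbhd i` an element of `D` will be given the value `e i`, its values elsewhere being free.
  -- Disjointness makes this unambiguous, and `P` bounds the region that is sacrificed.
  record DisjointNeighbourhoods {q} (P : Fin n → Pred X.Carrier q)
      : Set (Level.suc (b ⊔ ℓb) ⊔ q) where
    field
      nbhd     : Fin n → Clopen
      centre   : ∀ i → x i ∋ nbhd i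
      within   : ∀ i (z : X.Carrier) → z ∋ nbhd i → z ∈ P i
      disjoint : ∀ i j (z : X.Carrier) → z ∋ nbhd i → z ∋ nbhd j → i ≡ j

    cover? : ∀ z → (∃[ i ] z ∋ nbhd i) ⊎ (∀ i → z ∌ nbhd i)
    cover? z with em {P = ∃[ i ] z ∋ nbhd i}
    ... | yes p = inj₁ p
    ... | no ¬p = inj₂ λ i z∋ → ¬p (i , z∋)

  abstract

    -- Let `c i` be a clopen set around `x i` that contains no other `x j`. The neighbourhood of
    -- `x i` is taken inside `c i` and outside every `c j` with `j` different from `i`, so it cannot
    -- meet the neighbourhood of `x j`, which lies in `c j`.
    disjointNeighbourhoods : ∀ {q} {P : Fin n → Pred X.Carrier q} →
      (∀ i → X.Near (x i) (P i)) → DisjointNeighbourhoods P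
    disjointNeighbourhoods {P = P} near-P = record
      { nbhd     = λ i → proj₁ (small i)
      ; centre   = λ i → proj₁ (proj₂ (small i))
      ; within   = λ i z p → proj₁ (proj₂ (proj₂ (small i)) z p)
      ; disjoint = λ i j z p q →
          let _ , _ , sep = proj₂ (proj₂ (small i)) z p
              _ , z∋cⱼ , _ = proj₂ (proj₂ (small j)) z q
          in sep j z∋cⱼ
      }
      where
      c : Fin n → Clopen
      c i = proj₁ (isolated i)

      near-apart : ∀ i j → X.Near (x i) (λ z → z ∋ c j → i ≡ j)
      near-apart i j with em {P = x i ∋ c j}
      ... | yes xᵢ∋cⱼ = near-everywhere (x i) λ _ _ →
        ≡.sym (proj₂ (proj₂ (isolated j)) (x i) xᵢ∋cⱼ i (X.refl {x i}))
      ... | no  xᵢ∌cⱼ = X.near-map (x i) (λ _ z∉ z∈ → ⊥-elim (z∉ z∈)) (near-out {x i} xᵢ∌cⱼ)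

      small : ∀ i → X.Near (x i)
        (λ z → z ∈ P i × z ∋ c i × (∀ j → z ∋ c j → i ≡ j))
      small i = X.near-∩ (x i) (near-P i)
        (X.near-∩ (x i) (near-in {x i} (proj₁ (proj₂ (isolated i))))
          (X.near-⋂ (x i) (near-apart i)))

-- Gluing and patching locally constant maps

module LocallyConstantMaps (em : Classical) {b ℓb} (B : BooleanAlgebra b ℓb)
  {c ℓ} (S : Setoid c ℓ) {n} (x : Fin n → Ultrafilter B)
  (x-distinct : ∀ i j → Space._≈_ (StoneSpace B) (x i) (x j) → i ≡ j)
  where

  open BooleanAlgebra B using () renaming (Carrier to Clopen)
  open StonePoints em B x x-distinct
  private
    X = StoneSpace B
    module X = Space X
    module S = Setoid S
    LC : (X.Carrier → S.Carrier) → Set _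
    LC = LocallyConstant X S

  glue : Clopen → (f g : X.Carrier → S.Carrier) → X.Carrier → S.Carrier
  glue c f g y = if does (em {P = y ∋ c}) then f y else g y

  module _ {c : Clopen} {f g : X.Carrier → S.Carrier} where

    glue-in : ∀ {y} → y ∋ c → glue c f g y S.≈ f y
    glue-in {y} y∋c with em {P = y ∋ c}
    ... | yes _  = S.refl
    ... | no y∌c = ⊥-elim (y∌c y∋c)

    glue-out : ∀ {y} → y ∌ c → glue c f g y S.≈ g y
    glue-out {y} y∌c with em {P = y ∋ c}
    ... | yes y∋c = ⊥-elim (y∌c y∋c)
    ... | no _    = S.refl

    glue-lc : LC f → LC g → LC (glue c f g)
    glue-lc f-lc g-lc y with em {P = y ∋ c}
    ... | yes y∋c = X.near-map y (λ z (z∋c , p) → S.trans (glue-in z∋c) p)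
                      (X.near-∩ y (near-in {y} y∋c) (f-lc y))
    ... | no  y∌c = X.near-map y (λ z (z∌c , p) → S.trans (glue-out z∌c) p)
                      (X.near-∩ y (near-out {y} y∌c) (g-lc y))

  const-lc : ∀ s → LC (λ _ → s)
  const-lc s y = near-everywhere y λ _ → S.refl

  module Patch {q} {P : Fin n → Pred X.Carrier q} (N : DisjointNeighbourhoods P)
               (e : Fin n → S.Carrier) where

    open DisjointNeighbourhoods N

    patch : (X.Carrier → S.Carrier) → X.Carrier → S.Carrier
    patch f y with em {P = ∃[ i ] y ∋ nbhd i}
    ... | yes (i , _) = e i
    ... | no _        = f y

    patch-in : ∀ {f} i y → y ∋ nbhd i → patch f y S.≈ e i
    patch-in i y p with em {P = ∃[ i ] y ∋ nbhd i}
    -- The index chosen by `em` may differ from `i`; disjointness identifies the two.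
    ... | yes (j , q) = S.reflexive (≡.cong e (disjoint j i y q p))
    ... | no ¬p       = ⊥-elim (¬p (i , p))

    patch-out : ∀ {f} y → (∀ i → y ∌ nbhd i) → patch f y S.≈ f y
    patch-out y p with em {P = ∃[ i ] y ∋ nbhd i}
    ... | yes (j , q) = ⊥-elim (p j q)
    ... | no _        = S.refl

    patch-lc : ∀ {f} → LC f → LC (patch f)
    patch-lc f-lc y with em {P = ∃[ i ] y ∋ nbhd i}
    ... | yes (i , p) = X.near-map y (λ z → patch-in i z) (near-in {y} p)
    ... | no ¬p       = X.near-map y (λ z (q , r) → S.trans (patch-out z q) r)
      (X.near-∩ y (X.near-⋂ y (λ i → near-out {y} (λ p → ¬p (i , p)))) (f-lc y))

continuous-from-base : ∀ {p e i k p′ e′ i′ k′} (X : Space p e i k) (Y : Space p′ e′ i′ k′)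
  (f : Space.Carrier X → Space.Carrier Y) →
  (∀ y c → f y ∈ Space.⟦_⟧ Y c → Space.Near X y (λ z → f z ∈ Space.⟦_⟧ Y c)) →
  Continuous X Y f
continuous-from-base X Y f near U-open y fy∈U =
  let c , fy∈c , c⊆U = U-open (f y) fy∈U
  in Space.near-map X y (λ z → c⊆U (f z)) (near y c fy∈c)

-- Split group extensions

module _ {c ℓ c′ ℓ′} (G : Group c ℓ) (H : Group c′ ℓ′) where

  private
    module G = Group G
    module H = Group H
  open GroupProperties H using (inverseˡ-unique; identityˡ-unique)

  isHom : (f : G.Carrier → H.Carrier) → (∀ {u v} → u G.≈ v → f u H.≈ f v) →
          (∀ u v → f (u G.∙ v) H.≈ f u H.∙ f v) → IsHom G H f
  isHom f f-cong f-∙ = record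
    { isMonoidHomomorphism = record
      { isMagmaHomomorphism = record
        { isRelHomomorphism = record { cong = f-cong }
        ; homo = f-∙
        }
      ; ε-homo = f-ε
      }
    ; ⁻¹-homo = λ u → inverseˡ-unique (f (u G.⁻¹)) (f u)
        (H.trans (H.sym (f-∙ (u G.⁻¹) u)) (H.trans (f-cong (G.inverseˡ u)) f-ε))
    }
    where
    f-ε : f G.ε H.≈ H.ε
    f-ε = identityˡ-unique _ _ (H.trans (H.sym (f-∙ G.ε G.ε)) (f-cong (G.identityˡ G.ε)))

module SplitExtension {c ℓ c′ ℓ′} (G : Group c ℓ) (H : Group c′ ℓ′)
  (h : Group.Carrier G → Group.Carrier H) (h-hom : IsHom G H h)
  (s : Group.Carrier H → Group.Carrier G) (s-hom : IsHom H G s)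
  (h∘s : ∀ σ → Group._≈_ H (h (s σ)) σ)
  where

  private
    module G = Group G
    module H = Group H
    module h = GroupMorphisms.IsGroupHomomorphism h-hom
    module s = GroupMorphisms.IsGroupHomomorphism s-hom
    N = kernel G H h-hom
    module N = Group N

  open G using (_∙_; _⁻¹; _≈_)
  open GroupProperties G
  private module G-Reasoning = SetoidReasoning G.setoid

  conj : G.Carrier → G.Carrier → G.Carrier
  conj g n = g ∙ n ∙ g ⁻¹

  conj-cong : ∀ {g g′ n n′} → g ≈ g′ → n ≈ n′ → conj g n ≈ conj g′ n′
  conj-cong p q = G.∙-cong (G.∙-cong p q) (G.⁻¹-cong p)

  conj-ε : ∀ n → conj G.ε n ≈ n
  conj-ε n = begin
    G.ε ∙ n ∙ G.ε ⁻¹  ≈⟨ G.∙-cong (G.identityˡ n) ε⁻¹≈ε ⟩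
    n ∙ G.ε           ≈⟨ G.identityʳ n ⟩
    n                 ∎
    where open G-Reasoning

  conj-∙ : ∀ g g′ n → conj (g ∙ g′) n ≈ conj g (conj g′ n)
  conj-∙ g g′ n = begin
    g ∙ g′ ∙ n ∙ (g ∙ g′) ⁻¹         ≈⟨ G.∙-cong (G.assoc g g′ n) (⁻¹-anti-homo-∙ g g′) ⟩
    g ∙ (g′ ∙ n) ∙ (g′ ⁻¹ ∙ g ⁻¹)    ≈⟨ G.assoc _ _ _ ⟨
    g ∙ (g′ ∙ n) ∙ g′ ⁻¹ ∙ g ⁻¹      ≈⟨ G.∙-congʳ (G.assoc _ _ _) ⟩
    g ∙ (g′ ∙ n ∙ g′ ⁻¹) ∙ g ⁻¹      ∎
    where open G-Reasoning

  conj-homo : ∀ g n n′ → conj g (n ∙ n′) ≈ conj g n ∙ conj g n′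
  conj-homo g n n′ = begin
    g ∙ (n ∙ n′) ∙ g ⁻¹               ≈⟨ G.∙-congʳ (G.assoc g n n′) ⟨
    g ∙ n ∙ n′ ∙ g ⁻¹                 ≈⟨ G.∙-congʳ (G.∙-congʳ (//-rightDividesˡ g (g ∙ n))) ⟨
    conj g n ∙ g ∙ n′ ∙ g ⁻¹          ≈⟨ G.∙-congʳ (G.assoc _ _ _) ⟩
    conj g n ∙ (g ∙ n′) ∙ g ⁻¹        ≈⟨ G.assoc _ _ _ ⟩
    conj g n ∙ conj g n′              ∎
    where open G-Reasoning

  h-conj : ∀ g {n} → h n H.≈ H.ε → h (conj g n) H.≈ H.ε
  h-conj g {n} hn≈ε = begin
    h (g ∙ n ∙ g ⁻¹)            ≈⟨ h.homo _ _ ⟩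
    h (g ∙ n) H.∙ h (g ⁻¹)      ≈⟨ H.∙-cong (h.homo g n) (h.⁻¹-homo g) ⟩
    h g H.∙ h n H.∙ h g H.⁻¹    ≈⟨ H.∙-congʳ (H.trans (H.∙-congˡ hn≈ε) (H.identityʳ _)) ⟩
    h g H.∙ h g H.⁻¹            ≈⟨ H.inverseʳ (h g) ⟩
    H.ε                         ∎
    where open SetoidReasoning H.setoid

  act : H.Carrier → N.Carrier → N.Carrier
  act σ (n , n∈N) = conj (s σ) n , h-conj (s σ) n∈N

  act-cong : ∀ {σ τ} {n n′ : N.Carrier} → σ H.≈ τ → n N.≈ n′ → act σ n N.≈ act τ n′
  act-cong p q = conj-cong (s.⟦⟧-cong p) q

  act-∙ : ∀ σ τ (n : N.Carrier) → act (σ H.∙ τ) n N.≈ act σ (act τ n)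
  act-∙ σ τ (n , _) = G.trans (conj-cong (s.homo σ τ) G.refl) (conj-∙ (s σ) (s τ) n)

  act-ε : ∀ (n : N.Carrier) → act H.ε n N.≈ n
  act-ε (n , _) = G.trans (conj-cong s.ε-homo G.refl) (conj-ε n)

  act-inverse : ∀ {σ τ} → σ H.∙ τ H.≈ H.ε →
                ∀ {n n′ : N.Carrier} → n N.≈ act τ n′ → act σ n N.≈ n′
  act-inverse {σ} {τ} στ≈ε {n} {n′} p = G.trans (act-cong {n = n} {act τ n′} H.refl p)
    (G.trans (G.sym (act-∙ σ τ n′))
      (G.trans (act-cong {n = n′} {n′} στ≈ε G.refl) (act-ε n′)))

  action : Action H (kernel G H h-hom)
  action = record
    { ⟦_⟧ = λ σ → record
        { to        = act σ
        ; from      = act (σ H.⁻¹)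
        ; to-cong   = λ {n} {n′} → act-cong {n = n} {n′} H.refl
        ; from-cong = λ {n} {n′} → act-cong {n = n} {n′} H.refl
        ; inverse   = (λ {n} {n′} → act-inverse (H.inverseʳ σ) {n′} {n})
                    , (λ {n} {n′} → act-inverse (H.inverseˡ σ) {n′} {n})
        } , isHom N N (act σ) (λ {n} {n′} → act-cong {n = n} {n′} H.refl)
              (λ n n′ → conj-homo (s σ) (proj₁ n) (proj₁ n′))
    ; isGroupHomomorphism = isHom H (groupAut N) _
        (λ p n → act-cong {n = n} {n} p G.refl) act-∙
    }

  -- The factorisation of `g` as `(g ∙ s (h g) ⁻¹) ∙ s (h g)`, a kernel element times an element of
  -- the complement given by `s`.
  decompose : G.Carrier → N.Carrier × H.Carrier
  decompose g = (g ∙ s (h g) ⁻¹ , H.trans (h.homo _ _)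
    (H.trans (H.∙-congˡ (H.trans (h.⁻¹-homo _) (H.⁻¹-cong (h∘s (h g))))) (H.inverseʳ (h g)))) , h g

  G≅N⋊H : G ≅ semidirect (kernel G H h-hom) H action
  G≅N⋊H = decompose , record
    { isGroupMonomorphism = record
      { isGroupHomomorphism = isHom G (semidirect N H action) decompose
          (λ p → G.∙-cong p (G.⁻¹-cong (s.⟦⟧-cong (h.⟦⟧-cong p))) , h.⟦⟧-cong p)
          (λ g g′ → decompose-∙ g g′ , h.homo g g′)
      ; injective = λ {g} {g′} (p , q) → ∙-cancelʳ (s (h g) ⁻¹) g g′
          (G.trans p (G.∙-congˡ (G.⁻¹-cong (s.⟦⟧-cong (H.sym q)))))
      }
    ; surjective = λ ((n , n∈N) , σ) →
        let h≈σ : h (n ∙ s σ) H.≈ σ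
            h≈σ = H.trans (h.homo n (s σ)) (H.trans (H.∙-cong n∈N (h∘s σ)) (H.identityˡ σ))
        in n ∙ s σ , λ {g} p →
          G.trans (G.∙-cong p (G.⁻¹-cong (s.⟦⟧-cong (H.trans (h.⟦⟧-cong p) h≈σ))))
                  (//-rightDividesʳ (s σ) n)
          , H.trans (h.⟦⟧-cong p) h≈σ
    }
    where
    decompose-∙ : ∀ g g′ → (g ∙ g′) ∙ s (h (g ∙ g′)) ⁻¹ ≈
                           (g ∙ s (h g) ⁻¹) ∙ conj (s (h g)) (g′ ∙ s (h g′) ⁻¹)
    decompose-∙ g g′ = begin
      (g ∙ g′) ∙ s (h (g ∙ g′)) ⁻¹
        ≈⟨ G.∙-congˡ (G.⁻¹-cong (G.trans (s.⟦⟧-cong (h.homo g g′)) (s.homo _ _))) ⟩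
      (g ∙ g′) ∙ (k ∙ k′) ⁻¹          ≈⟨ G.∙-congˡ (⁻¹-anti-homo-∙ k k′) ⟩
      (g ∙ g′) ∙ (k′ ⁻¹ ∙ k ⁻¹)       ≈⟨ G.assoc _ _ _ ⟨
      (g ∙ g′) ∙ k′ ⁻¹ ∙ k ⁻¹         ≈⟨ G.∙-congʳ (G.assoc _ _ _) ⟩
      g ∙ (g′ ∙ k′ ⁻¹) ∙ k ⁻¹         ≈⟨ G.∙-congʳ (G.∙-congʳ (//-rightDividesˡ k g)) ⟨
      g ∙ k ⁻¹ ∙ k ∙ (g′ ∙ k′ ⁻¹) ∙ k ⁻¹
        ≈⟨ G.∙-congʳ (G.assoc _ _ _) ⟩
      g ∙ k ⁻¹ ∙ (k ∙ (g′ ∙ k′ ⁻¹)) ∙ k ⁻¹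
        ≈⟨ G.assoc _ _ _ ⟩
      (g ∙ k ⁻¹) ∙ conj k (g′ ∙ k′ ⁻¹) ∎
      where
      open G-Reasoning
      k = s (h g)
      k′ = s (h g′)

-- Automorphisms of filtered Boolean powers

module AutomorphismsOfFilteredPower
  (em : Classical)
  {s a ℓa b ℓb} {S : Signature s} (A : Algebra S a ℓa) (finite : Finite (Algebra.setoid A))
  (simple : Simple A) (mal : Mal'cev A) (nonabelian : ¬ Abelian A)
  {n} (e : Fin n → Algebra.Carrier A) (e-idem : ∀ i → IsIdempotent A (e i))
  (distinct-orbits : ∀ i j → SameOrbit A (e i) (e j) → i ≡ j)
  (B : BooleanAlgebra b ℓb) (x : Fin n → Ultrafilter B)
  (x-distinct : ∀ i j → Space._≈_ (StoneSpace B) (x i) (x j) → i ≡ j)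
  where

  open FilteredPower em A B e e-idem x hiding (Away)
  open StonePoints em B x x-distinct
  open LocallyConstantMaps em B (Algebra.setoid A) x x-distinct
  open Ultrafilters em B
  open Resizing em
  open BooleanAlgebra B using (_∧_) renaming (Carrier to Clopen; ¬_ to infix 8 ∁_)
  private
    module A = Algebra A
    module K = Group K
    module A-Reasoning = SetoidReasoning A.setoid
    module X-Reasoning = SetoidReasoning X.points
    LC : (X.Carrier → A.Carrier) → Set _
    LC = LocallyConstant X A.setoid

  -- Elements of `D` with prescribed values

  element : (f : X.Carrier → A.Carrier) → LC f → (∀ i → f (x i) A.≈ e i) → D.Carrier
  element f f-lc f-x = (f , locallyConstant⇒continuous X A.setoid f-lc) , f-x

  π-lc : ∀ f → LC (λ y → π y f)
  π-lc f = continuous⇒locallyConstant X A.setoid (proj₂ (proj₁ f))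

  π-cong : ∀ f y z → y X.≈ z → π y f A.≈ π z f
  π-cong f = locallyConstant⇒cong X A.setoid (π-lc f)

  π-x : ∀ f {i y} → y X.≈ x i → π y f A.≈ e i
  π-x f {i} {y} y≈xᵢ = A.trans (π-cong f y (x i) y≈xᵢ) (proj₂ f i)

  agree-near : ∀ f g y → π y f A.≈ π y g → X.Near y (λ z → π z f A.≈ π z g)
  agree-near f g y p = X.near-map y (λ z (q , r) → A.trans q (A.trans p (A.sym r)))
    (X.near-∩ y (π-lc f y) (π-lc g y))

  module _ {q} {P : Fin n → Pred X.Carrier q} (N : DisjointNeighbourhoods P) where

    open DisjointNeighbourhoods N
    open Patch N e

    patched : ∀ {f} → LC f → D.Carrier
    patched {f} f-lc = element (patch f) (patch-lc f-lc) (λ i → patch-in i (x i) (centre i))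

    π-patched-in : ∀ {f} (f-lc : LC f) i y → y ∋ nbhd i → π y (patched f-lc) A.≈ e i
    π-patched-in f-lc i y = patch-in i y

    π-patched-out : ∀ {f} (f-lc : LC f) y → (∀ i → y ∌ nbhd i) → π y (patched f-lc) A.≈ f y
    π-patched-out f-lc y = patch-out y

  -- The clopen set `avoider` contains `y` and none of the `x i`. The patches lie outside it, so on
  -- `avoider` an element of `D` may take arbitrary locally constant values.
  module Avoiding (y : X.Carrier) (y-away : Away y) where

    avoider : Clopen
    avoider = proj₁ (away-open y y-away)

    y∋avoider : y ∋ avoider
    y∋avoider = proj₁ (proj₂ (away-open y y-away))

    avoiding : DisjointNeighbourhoods (λ _ z → z ∌ avoider)
    avoiding = disjointNeighbourhoods λ i → near-out {x i} λ xᵢ∋ →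
      proj₂ (proj₂ (away-open y y-away)) (x i) xᵢ∋ i (X.refl {x i})

    open DisjointNeighbourhoods avoiding

    out : ∀ i z → z ∋ avoider → z ∌ nbhd i
    out i z z∋ z∋nbhd = within i z z∋nbhd z∋

    through : A.Carrier → D.Carrier
    through u = patched avoiding (const-lc u)

    π-through : ∀ u → π y (through u) A.≈ u
    π-through u = π-patched-out avoiding (const-lc u) y λ i → out i y y∋avoider

    -- Both elements are `e i` on the patches. Elsewhere one is `v`, and the other is `u` on
    -- `avoider ∧ c` and `v` off it. Through such pairs the congruences `θ z` detect membership of
    -- points in clopen sets.
    bump : ∀ {u v} → ¬ u A.≈ v → ∀ c → y ∋ c →
           ∃[ f ] ∃[ g ] ¬ π y f A.≈ π y g × (∀ z → z ∌ c → π z f A.≈ π z g)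
    bump {u} {v} u≉v c y∋c = f , through v , differ , agree
      where
      glued-lc : LC (glue (avoider ∧ c) (λ _ → u) (λ _ → v))
      glued-lc = glue-lc (const-lc u) (const-lc v)

      f : D.Carrier
      f = patched avoiding glued-lc

      y∋both : y ∋ avoider ∧ c
      y∋both = Ultrafilter.∧-mem y y∋avoider y∋c

      differ : ¬ π y f A.≈ π y (through v)
      differ p = u≉v (begin
        u                                   ≈⟨ glue-in {y = y} y∋both ⟨
        glue (avoider ∧ c) (λ _ → u) (λ _ → v) y
          ≈⟨ π-patched-out avoiding glued-lc y (λ i → out i y y∋avoider) ⟨
        π y f                               ≈⟨ p ⟩
        π y (through v)                     ≈⟨ π-through v ⟩
        v                                   ∎)
        where open A-Reasoning

      agree : ∀ z → z ∌ c → π z f A.≈ π z (through v)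
      agree z z∌c with cover? z
      ... | inj₁ (i , z∋nbhd) = A.trans (π-patched-in avoiding glued-lc i z z∋nbhd)
        (A.sym (π-patched-in avoiding (const-lc v) i z z∋nbhd))
      ... | inj₂ outside = A.trans (π-patched-out avoiding glued-lc z outside)
        (A.trans
          (glue-out {y = z} λ z∋both →
            z∌c (Ultrafilter.upward z (∧-lowerʳ avoider c) z∋both))
          (A.sym (π-patched-out avoiding (const-lc v) z outside)))

  private
    m = proj₁ mal
    M = ternary A m
    MD = ternary D m

  a₀ a₁ : A.Carrier
  a₀ = proj₁ (proj₁ simple)
  a₁ = proj₁ (proj₂ (proj₁ simple))

  a₀≉a₁ : ¬ a₀ A.≈ a₁
  a₀≉a₁ = proj₂ (proj₂ (proj₁ simple))

  Mˡ : ∀ {u u′ v} → u A.≈ u′ → M u u′ v A.≈ v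
  Mˡ p = A.trans (ternary-cong A m p A.refl A.refl) (proj₁ (proj₂ mal _ _))

  Mʳ : ∀ {u v v′} → v A.≈ v′ → M u v v′ A.≈ u
  Mʳ p = A.trans (ternary-cong A m A.refl p A.refl) (proj₂ (proj₂ mal _ _))

  π-MD : ∀ z f g k → π z (MD f g k) A.≈ M (π z f) (π z g) (π z k)
  π-MD z = ternary-homo D A (π z) (λ _ _ → A.refl) m

  πf : D.Carrier → X.Carrier → A.Carrier
  πf f y = π y f

  Agree : Clopen → D.Carrier → D.Carrier → Set _
  Agree c f g = ∀ z → z ∋ c → π z f A.≈ π z g

  -- Surjective homomorphisms from `D` to `A`

  module Factor
    (q : D.Carrier → A.Carrier)
    (q-cong : ∀ {f g} → f D.≈ g → q f A.≈ q g)
    (q-op : ∀ o v → q (D.op o v) A.≈ A.op o (q ∘ v))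
    (q-surjective : ∀ u → ∃[ f ] q f A.≈ u)
    where

    q-MD : ∀ f g k → q (MD f g k) A.≈ M (q f) (q g) (q k)
    q-MD = ternary-homo D A q q-op m

    not-constant : ¬ (∀ f g → q f A.≈ q g)
    not-constant const = let f , qf≈ = q-surjective a₀ ; g , qg≈ = q-surjective a₁
      in a₀≉a₁ (A.trans (A.sym qf≈) (A.trans (const f g) qg≈))

    Collapses : Clopen → Set _
    Collapses c = ∀ f g → Agree c f g → q f A.≈ q g

    -- The image under `q` of the congruence `Agree c` of `D`.
    record Linked (c : Clopen) (u v : A.Carrier) : Set (a ⊔ Level.suc (b ⊔ ℓb ⊔ ℓa)) where
      field
        {fst snd} : D.Carrier
        agree     : Agree c fst snd
        q-fst     : q fst A.≈ u
        q-snd     : q snd A.≈ v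

    open Linked

    -- For transitivity, the two lifts of the middle element have the same image but may be
    -- different. The Mal'cev term bridges them: `MD (fst uv) (snd uv) (fst vw)` agrees with
    -- `fst vw` on `c` and has the same image under `q` as `fst uv`.
    Linked-isCongruence : ∀ c → IsCongruence A (λ u v → Resize ℓa (Linked c u v))
    Linked-isCongruence c = record
      { isEquivalence = record
        { refl  = of-≈ A.refl
        ; sym   = λ p → let uv = unresize p in resize record
            { agree = λ z z∋c → A.sym (agree uv z z∋c)
            ; q-fst = q-snd uv
            ; q-snd = q-fst uv
            }
        ; trans = λ p r → let uv = unresize p ; vw = unresize r in resize record
            { agree = λ z z∋c → A.trans (π-MD z (fst uv) (snd uv) (fst vw))
                (A.trans (Mˡ (agree uv z z∋c)) (agree vw z z∋c))
            ; q-fst = A.trans (q-MD (fst uv) (snd uv) (fst vw))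
                (A.trans (Mʳ (A.trans (q-snd uv) (A.sym (q-fst vw)))) (q-fst uv))
            ; q-snd = q-snd vw
            }
        }
      ; reflexive  = of-≈
      ; compatible = λ o p → resize record
          { agree = λ z z∋c → A.op-cong o λ j → agree (unresize (p j)) z z∋c
          ; q-fst = A.trans (q-op o _) (A.op-cong o λ j → q-fst (unresize (p j)))
          ; q-snd = A.trans (q-op o _) (A.op-cong o λ j → q-snd (unresize (p j)))
          }
      }
      where
      of-≈ : ∀ {u v} → u A.≈ v → Resize ℓa (Linked c u v)
      of-≈ {u} u≈v = let f , qf≈u = q-surjective u in resize record
        { fst   = f
        ; snd   = f
        ; agree = λ _ _ → A.refl
        ; q-fst = qf≈u
        ; q-snd = A.trans qf≈u u≈v
        }

    -- By simplicity the image congruence is equality or full, and equality would say that `c`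
    -- collapses.
    all-linked : ∀ c → ¬ Collapses c → ∀ u v → Linked c u v
    all-linked c ¬collapses =
      [ (λ trivial → ⊥-elim (¬collapses λ f g f~g →
          trivial (resize record { agree = f~g ; q-fst = A.refl ; q-snd = A.refl })))
      , (λ full u v → unresize (full u v))
      ]′ (proj₂ simple _ (Linked-isCongruence c))

    -- For `f`, `g` agreeing on `c` and `u`, `v` agreeing off `c`, the Mal'cev identities
    -- give `M(t(g,u), t(f,u), t(f,v)) = t(g,v)` pointwise.
    module _ (c : Clopen)
      (linked : ∀ u v → Linked c u v) (linked-∁ : ∀ u v → Linked (∁ c) u v) where

      module _ o (w f g u v : Fin (Signature.arity S o) → D.Carrier)
        (f~g : ∀ j → Agree c (f j) (g j)) (u~v : ∀ j → Agree (∁ c) (u j) (v j)) where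

        private
          t : (f u : Fin (Signature.arity S o) → D.Carrier) → D.Carrier
          t f u = D.op o (λ j → MD (f j) (w j) (u j))

          t-cong : ∀ z {f f′ u u′} → (∀ j → π z (f j) A.≈ π z (f′ j)) →
            (∀ j → π z (u j) A.≈ π z (u′ j)) → π z (t f u) A.≈ π z (t f′ u′)
          t-cong z p r = A.op-cong o λ j → A.trans (π-MD z _ _ _)
            (A.trans (ternary-cong A m (p j) A.refl (r j)) (A.sym (π-MD z _ _ _)))

        rectangle : MD (t g u) (t f u) (t f v) D.≈ t g v
        rectangle z = A.trans (π-MD z _ _ _) ([ on-c , off-c ]′ (z ∋? c))
          where
          on-c : z ∋ c → M (π z (t g u)) (π z (t f u)) (π z (t f v)) A.≈ π z (t g v)
          on-c z∋c = A.trans (Mˡ (t-cong z (λ j → A.sym (f~g j z z∋c)) (λ _ → A.refl)))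
            (t-cong z (λ j → f~g j z z∋c) (λ _ → A.refl))

          off-c : z ∌ c → M (π z (t g u)) (π z (t f u)) (π z (t f v)) A.≈ π z (t g v)
          off-c z∌c = A.trans (Mʳ (t-cong z (λ _ → A.refl) (λ j → u~v j z (∁-mem z z∌c))))
            (t-cong z (λ _ → A.refl) (λ j → u~v j z (∁-mem z z∌c)))

        q-t : ∀ f u → q (t f u) A.≈ A.op o (λ j → M (q (f j)) (q (w j)) (q (u j)))
        q-t f u = A.trans (q-op o _) (A.op-cong o λ j → q-MD _ _ _)

        q-rectangle :
          M (A.op o (λ j → M (q (g j)) (q (w j)) (q (u j))))
            (A.op o (λ j → M (q (f j)) (q (w j)) (q (u j))))
            (A.op o (λ j → M (q (f j)) (q (w j)) (q (v j))))
          A.≈ A.op o (λ j → M (q (g j)) (q (w j)) (q (v j)))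
        q-rectangle = A.trans
          (ternary-cong A m (A.sym (q-t g u)) (A.sym (q-t f u)) (A.sym (q-t f v)))
          (A.trans (A.sym (q-MD _ _ _)) (A.trans (q-cong rectangle) (q-t g v)))

      -- The four corners of the rectangle are made to lie over `op o u`, `op o w`, `op o v` and
      -- `op o` of the tuple `M (u j) (w j) (v j)`. The pair agreeing on `c` lies over `w j` and
      -- `u j`, the pair agreeing off `c` over `w j` and `v j`, and the middle argument `w′ j` over
      -- `w j`; in the first three corners the Mal'cev identities cancel a repeated `w j`.
      M-commutes : ∀ o (u w v : Fin (Signature.arity S o) → A.Carrier) →
        M (A.op o u) (A.op o w) (A.op o v) A.≈ A.op o (λ j → M (u j) (w j) (v j))
      M-commutes o u w v = begin
        M (A.op o u) (A.op o w) (A.op o v)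
          ≈⟨ ternary-cong A m
               (A.op-cong o λ j → A.trans (Mʳ (A.trans (w′≈ j) (A.sym (q-fst (wv j))))) (q-snd (wu j)))
               (A.op-cong o λ j → A.trans (Mˡ (A.trans (q-fst (wu j)) (A.sym (w′≈ j)))) (q-fst (wv j)))
               (A.op-cong o λ j → A.trans (Mˡ (A.trans (q-fst (wu j)) (A.sym (w′≈ j)))) (q-snd (wv j))) ⟨
        M (A.op o (λ j → M (q (snd (wu j))) (q (w′ j)) (q (fst (wv j)))))
          (A.op o (λ j → M (q (fst (wu j))) (q (w′ j)) (q (fst (wv j)))))
          (A.op o (λ j → M (q (fst (wu j))) (q (w′ j)) (q (snd (wv j)))))
          ≈⟨ q-rectangle o w′ _ _ _ _ (λ j → agree (wu j)) (λ j → agree (wv j)) ⟩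
        A.op o (λ j → M (q (snd (wu j))) (q (w′ j)) (q (snd (wv j))))
          ≈⟨ A.op-cong o (λ j → ternary-cong A m (q-snd (wu j)) (w′≈ j) (q-snd (wv j))) ⟩
        A.op o (λ j → M (u j) (w j) (v j)) ∎
        where
        open A-Reasoning

        wu : ∀ j → Linked c (w j) (u j)
        wu j = linked (w j) (u j)

        wv : ∀ j → Linked (∁ c) (w j) (v j)
        wv j = linked-∁ (w j) (v j)

        w′ : Fin (Signature.arity S o) → D.Carrier
        w′ j = proj₁ (q-surjective (w j))

        w′≈ : ∀ j → q (w′ j) A.≈ w j
        w′≈ j = proj₂ (q-surjective (w j))

    collapses-prime : ∀ c → Collapses c ⊎ Collapses (∁ c)
    collapses-prime c with em {P = Collapses c} | em {P = Collapses (∁ c)}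
    ... | yes p | _     = inj₁ p
    ... | no _  | yes p = inj₂ p
    ... | no ¬p | no ¬r = ⊥-elim (nonabelian (CommutingMal'cev.abelian A mal
      (M-commutes c (all-linked c ¬p) (all-linked (∁ c) ¬r)) a₀))

    collapses-filter : IsProperFilter B (λ c → Resize (b ⊔ ℓb) (Collapses c))
    collapses-filter = record
      { ⊤∈F    = resize λ f g f~g → q-cong λ z → f~g z (Ultrafilter.⊤∈F z)
      -- The intermediate `k` is `f` on `c` and `g` off `c`. It agrees with `f` on `c`, and with `g`
      -- on all of `d` because `f` and `g` agree on `c ∧ d`.
      ; ∧-mem  = λ {c} {d} p r → resize λ f g f~g →
          let k-lc = glue-lc {c = c} (π-lc f) (π-lc g)
              k = element (glue c (πf f) (πf g)) k-lc (k-x c f g)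
          in A.trans
            (unresize p f k λ z z∋c → A.sym (glue-in {f = πf f} {πf g} {z} z∋c))
            (unresize r k g λ z z∋d → k~g c d f g f~g z z∋d)
      ; upward = λ c≤d p → resize λ f g f~g → unresize p f g λ z z∋c →
          f~g z (Ultrafilter.upward z c≤d z∋c)
      ; ⊥∉F    = λ p → not-constant λ f g → unresize p f g λ z z∋⊥ →
          ⊥-elim (Ultrafilter.⊥∉F z z∋⊥)
      }
      where
      k-x : ∀ c f g i → glue c (πf f) (πf g) (x i) A.≈ e i
      k-x c f g i =
        [ (λ xᵢ∋c → A.trans (glue-in {f = πf f} {πf g} {x i} xᵢ∋c) (proj₂ f i))
        , (λ xᵢ∌c → A.trans (glue-out {f = πf f} {πf g} {x i} xᵢ∌c) (proj₂ g i))
        ]′ (x i ∋? c)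

      k~g : ∀ c d f g → Agree (c ∧ d) f g → ∀ z → z ∋ d → glue c (πf f) (πf g) z A.≈ π z g
      k~g c d f g f~g z z∋d =
        [ (λ z∋c → A.trans (glue-in {f = πf f} {πf g} {z} z∋c)
            (f~g z (Ultrafilter.∧-mem z z∋c z∋d)))
        , glue-out {f = πf f} {πf g} {z}
        ]′ (z ∋? c)

    point : X.Carrier
    point = prime⇒ultrafilter _ collapses-filter (map resize resize ∘ collapses-prime)

    -- Agreement at a point spreads to a clopen neighbourhood, and the clopen sets containing
    -- `point` are by construction those that collapse.
    θ-point⊆ker : ∀ f g → π point f A.≈ π point g → q f A.≈ q g
    θ-point⊆ker f g p = let c , point∋c , f~g = agree-near f g point p in
      unresize point∋c f g f~g

    -- All elements of `D` agree at `x i`, so `q` would be constant if `point` were `x i`.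
    point-away : Away point
    point-away i point≈xᵢ = not-constant λ f g →
      θ-point⊆ker f g (A.trans (π-x f point≈xᵢ) (A.sym (π-x g point≈xᵢ)))

    open Avoiding point point-away

    α : A.Carrier → A.Carrier
    α u = q (through u)

    α-π : ∀ f → α (π point f) A.≈ q f
    α-π f = θ-point⊆ker _ f (π-through (π point f))

    α-cong : ∀ {u v} → u A.≈ v → α u A.≈ α v
    α-cong {u} {v} u≈v = θ-point⊆ker _ _
      (A.trans (π-through u) (A.trans u≈v (A.sym (π-through v))))

    α-op : ∀ o v → α (A.op o v) A.≈ A.op o (α ∘ v)
    α-op o v = A.trans
      (θ-point⊆ker _ (D.op o (through ∘ v)) (A.trans (π-through (A.op o v))
        (A.op-cong o λ j → A.sym (π-through (v j)))))
      (q-op o (through ∘ v))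

    -- The kernel of `α` is a congruence of a simple algebra; were it full, `q` would be constant.
    α-injective : ∀ {u v} → α u A.≈ α v → u A.≈ v
    α-injective = [ (λ injective → injective)
      , (λ constant → ⊥-elim (not-constant λ f g →
          A.trans (A.sym (α-π f)) (A.trans (constant _ _) (α-π g)))) ]′
      (proj₂ simple (λ u v → α u A.≈ α v) record
        { isEquivalence = record { refl = A.refl ; sym = A.sym ; trans = A.trans }
        ; reflexive     = α-cong
        ; compatible    = λ o {u} {v} p →
            A.trans (α-op o u) (A.trans (A.op-cong o p) (A.sym (α-op o v)))
        })

    α⁻¹ : A.Carrier → A.Carrier
    α⁻¹ u = π point (proj₁ (q-surjective u))

    α-α⁻¹ : ∀ u → α (α⁻¹ u) A.≈ u
    α-α⁻¹ u = A.trans (α-π (proj₁ (q-surjective u))) (proj₂ (q-surjective u))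

    automorphism : AutA.Carrier
    automorphism = record
      { to        = α
      ; from      = α⁻¹
      ; to-cong   = α-cong
      ; from-cong = λ {u} {v} u≈v → α-injective
          (A.trans (α-α⁻¹ u) (A.trans u≈v (A.sym (α-α⁻¹ v))))
      ; inverse   = (λ {u} p → A.trans (α-cong p) (α-α⁻¹ u))
                  , (λ {u} p → α-injective (A.trans (α-α⁻¹ _) p))
      } , α-op

  -- The maps on points and fibres induced by an automorphism

  infix 9 _⁻
  _⁻ : AutD.Carrier → AutD.Carrier
  _⁻ = AutD._⁻¹

  φφ⁻ : ∀ φ f → φ ·D φ ⁻ ·D f D.≈ f
  φφ⁻ φ = AutD.inverseʳ φ

  φ⁻φ : ∀ φ f → φ ⁻ ·D φ ·D f D.≈ f
  φ⁻φ φ = AutD.inverseˡ φ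

  ·D-cong : ∀ φ {f g} → f D.≈ g → φ ·D f D.≈ φ ·D g
  ·D-cong φ = Inverse.to-cong (proj₁ φ)

  ·A-cong : ∀ α {u v} → u A.≈ v → α ·A u A.≈ α ·A v
  ·A-cong α = Inverse.to-cong (proj₁ α)

  ·A-injective : ∀ α {u v} → α ·A u A.≈ α ·A v → u A.≈ v
  ·A-injective α {u} {v} p = A.trans (A.sym (AutA.inverseˡ α u))
    (A.trans (Inverse.from-cong (proj₁ α) p) (AutA.inverseˡ α v))

  -- If some clopen `c` contains `z` but not `y`, a bump at `z` inside `c` gives two elements that
  -- agree at `y` and differ at `z`.
  θ-injective : ∀ y z → Away z → (∀ f g → θ y f g → θ z f g) → y X.≈ z
  θ-injective y z z-away θy⊆θz = by-contradiction λ y≉z →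
    let c , z∋c , y∌c = stone-T₁ B em z y (λ z≈y → y≉z (X.sym {z} {y} z≈y))
        f , g , f≁g , f~g = Avoiding.bump z z-away a₀≉a₁ c z∋c
    in f≁g (θy⊆θz f g (f~g y y∌c))

  module _ (φ : AutD.Carrier) (y : X°.Carrier) where

    private
      surjective : ∀ u → ∃[ f ] π (proj₁ y) (φ ⁻ ·D f) A.≈ u
      surjective u = φ ·D through u , A.trans (φ⁻φ φ (through u) (proj₁ y)) (π-through u)
        where open Avoiding (proj₁ y) (proj₂ y)

      module F = Factor (λ f → π (proj₁ y) (φ ⁻ ·D f))
                     (λ {f} {g} f≈g → ·D-cong (φ ⁻) {f} {g} f≈g (proj₁ y))
                     (λ o v → proj₂ (φ ⁻) o v (proj₁ y))
                     surjective

    abstract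

      move : X°.Carrier
      move = F.point , F.point-away

      fibre : AutA.Carrier
      fibre = F.automorphism AutA.⁻¹

      fibre-spec : ∀ f → fibre ·A π (proj₁ y) f A.≈ π (proj₁ move) (φ ·D f)
      fibre-spec f = Inverse.inverseʳ (proj₁ F.automorphism)
        (A.sym (A.trans (F.α-π (φ ·D f)) (φ⁻φ φ f (proj₁ y))))

    fibre-unique : ∀ α → (∀ f → α ·A π (proj₁ y) f A.≈ π (proj₁ move) (φ ·D f)) →
                   α AutA.≈ fibre
    fibre-unique α α-spec u = A.trans (·A-cong α (A.sym (π-through u)))
      (A.trans (α-spec (through u)) (A.trans (A.sym (fibre-spec (through u)))
        (·A-cong fibre (π-through u))))
      where open Avoiding (proj₁ y) (proj₂ y)

    fibre-spec⁻ : ∀ f → fibre ·A π (proj₁ y) (φ ⁻ ·D f) A.≈ π (proj₁ move) f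
    fibre-spec⁻ f = A.trans (fibre-spec (φ ⁻ ·D f)) (φφ⁻ φ f (proj₁ move))

    θ-move : ∀ f g → θ (proj₁ y) f g → θ (proj₁ move) (φ ·D f) (φ ·D g)
    θ-move f g f~g = A.trans (A.sym (fibre-spec f))
      (A.trans (·A-cong fibre f~g) (fibre-spec g))

    θ-move⁻ : ∀ f g → θ (proj₁ y) (φ ⁻ ·D f) (φ ⁻ ·D g) → θ (proj₁ move) f g
    θ-move⁻ f g f~g = A.trans (A.sym (fibre-spec⁻ f))
      (A.trans (·A-cong fibre f~g) (fibre-spec⁻ g))

    θ-unmove : ∀ f g → θ (proj₁ move) f g → θ (proj₁ y) (φ ⁻ ·D f) (φ ⁻ ·D g)
    θ-unmove f g f~g = ·A-injective fibre (A.trans (fibre-spec⁻ f)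
      (A.trans f~g (A.sym (fibre-spec⁻ g))))

    -- By `θ-injective` an inclusion of congruences already identifies the points. To compute
    -- `move φ y` it is thus enough to see that `φ` carries agreement at `y` to agreement at `z`.
    move-unique : ∀ z → Away z → (∀ f g → θ (proj₁ y) f g → θ z (φ ·D f) (φ ·D g)) →
                  z X.≈ proj₁ move
    move-unique z z-away z-spec = X.sym {proj₁ move} {z}
      (θ-injective (proj₁ move) z z-away λ f g f~g →
        A.trans (A.sym (φφ⁻ φ f z)) (A.trans
          (z-spec (φ ⁻ ·D f) (φ ⁻ ·D g) (θ-unmove f g f~g)) (φφ⁻ φ g z)))

  move-cong : ∀ {φ χ} y z → φ AutD.≈ χ → y X°.≈ z → move φ y X°.≈ move χ z
  move-cong {φ} {χ} y z φ≈χ y≈z = move-unique χ z (proj₁ (move φ y)) (proj₂ (move φ y))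
    λ f g f~g → A.trans (A.sym (φ≈χ f (proj₁ (move φ y)))) (A.trans
      (θ-move φ y f g (A.trans (π-cong f _ _ y≈z) (A.trans f~g (A.sym (π-cong g _ _ y≈z)))))
      (φ≈χ g (proj₁ (move φ y))))

  move-∙ : ∀ φ χ y → move φ (move χ y) X°.≈ move (φ AutD.∙ χ) y
  move-∙ φ χ y = move-unique (φ AutD.∙ χ) y _ (proj₂ (move φ (move χ y)))
    λ f g f~g → θ-move φ (move χ y) (χ ·D f) (χ ·D g) (θ-move χ y f g f~g)

  move-ε : ∀ y → y X°.≈ move AutD.ε y
  move-ε y = move-unique AutD.ε y (proj₁ y) (proj₂ y) λ f g f~g → f~g

  move-cancel : ∀ φ χ → φ AutD.∙ χ AutD.≈ AutD.ε → ∀ y → move φ (move χ y) X°.≈ y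
  move-cancel φ χ φχ≈ε y = X°.trans {move φ (move χ y)} {move (φ AutD.∙ χ) y} {y} (move-∙ φ χ y)
    (X°.trans {move (φ AutD.∙ χ) y} {move AutD.ε y} {y}
      (move-cong {φ AutD.∙ χ} {AutD.ε} y y φχ≈ε (X°.refl {y}))
      (X°.sym {y} {move AutD.ε y} (move-ε y)))

  differ-near : ∀ f g y → ¬ θ y f g → X.Near y (λ z → ¬ θ z f g)
  differ-near f g y f≁g = X.near-map y
    (λ z (p , r) f~g → f≁g (A.trans (A.sym p) (A.trans f~g r)))
    (X.near-∩ y (π-lc f y) (π-lc g y))

  -- If two elements differ only inside `c`, their preimages under `φ` differ only at points
  -- which are moved into `c`.
  move-near : ∀ φ y c → proj₁ (move φ y) ∋ c → X°.Near y (λ z → proj₁ (move φ z) ∋ c)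
  move-near φ y c φy∋c =
    let f , g , f≁g , f~g = Avoiding.bump (proj₁ (move φ y)) (proj₂ (move φ y)) a₀≉a₁ c φy∋c
        d , y∋d , d⊆ = differ-near (φ ⁻ ·D f) (φ ⁻ ·D g) (proj₁ y)
          (λ p → f≁g (θ-move⁻ φ y f g p))
    in d , y∋d , λ z z∋d → [ (λ φz∋c → φz∋c)
      , (λ φz∌c → ⊥-elim (d⊆ (proj₁ z) z∋d (θ-unmove φ z f g (f~g _ φz∌c)))) ]′
      (proj₁ (move φ z) ∋? c)

  move-continuous : ∀ φ → Continuous X° X° (move φ)
  move-continuous φ = continuous-from-base X° X° (move φ) (move-near φ)

  homeo° : AutD.Carrier → Group.Carrier (Homeo X°)
  homeo° φ = record
    { to        = move φ
    ; from      = move (φ ⁻)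
    ; to-cong   = λ {y} {z} → move-cong {φ} {φ} y z (AutD.refl {φ})
    ; from-cong = λ {y} {z} → move-cong {φ ⁻} {φ ⁻} y z (AutD.refl {φ ⁻})
    ; inverse   = (λ {y} {z} → cancel {φ} {φ ⁻} (AutD.inverseʳ φ) {y} {z})
                , (λ {y} {z} → cancel {φ ⁻} {φ} (AutD.inverseˡ φ) {y} {z})
    } , move-continuous φ , move-continuous (φ ⁻)
    where
    cancel : ∀ {φ χ} → φ AutD.∙ χ AutD.≈ AutD.ε →
             ∀ {y z} → z X°.≈ move χ y → move φ z X°.≈ y
    cancel {φ} {χ} p {y} {z} z≈χy = X°.trans {move φ z} {move φ (move χ y)} {y}
      (move-cong {φ} {φ} z (move χ y) (AutD.refl {φ}) z≈χy) (move-cancel φ χ p y)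

  inducedMaps : InducedMaps
  inducedMaps = record
    { _°       = homeo°
    ; °-spec   = λ φ y →
        (λ {u} {v} (f , g , f~g , φf≈u , φg≈v) →
          let z = proj₁ (move φ y) in
          A.trans (A.sym (φf≈u z)) (A.trans (θ-move φ y f g f~g) (φg≈v z)))
      , (λ {u} {v} u~v → φ ⁻ ·D u , φ ⁻ ·D v , θ-unmove φ y u v u~v , φφ⁻ φ u , φφ⁻ φ v)
    ; °-unique = λ φ y z image≐θz → move-unique φ y (proj₁ z) (proj₂ z) λ f g f~g →
        proj₁ image≐θz {φ ·D f} {φ ·D g} (f , g , f~g , D.refl {φ ·D f} , D.refl {φ ·D g})
    ; _₍_₎     = fibre
    ; ₍₎-spec   = fibre-spec
    ; ₍₎-unique = fibre-unique
    }

  -- The map `bar φ` on the whole of `X`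

  open InducedMaps inducedMaps using (bar) public

  abstract

    bar-at : ∀ φ y {i} → y X.≈ x i → bar φ y X.≈ y
    bar-at φ y y≈xᵢ with em {P = ∃[ i ] y X.≈ x i}
    ... | yes _  = X.refl {y}
    ... | no ¬at = ⊥-elim (¬at (_ , y≈xᵢ))

    bar-away : ∀ φ y (y-away : Away y) → bar φ y X.≈ proj₁ (move φ (y , y-away))
    bar-away φ y y-away with em {P = ∃[ i ] y X.≈ x i}
    ... | yes (i , y≈xᵢ) = ⊥-elim (y-away i y≈xᵢ)
    ... | no ¬at = move-cong {φ} {φ}
      (y , λ i y≈xᵢ → ¬at (i , y≈xᵢ)) (y , y-away) (AutD.refl {φ}) (X.refl {y})

    bar-x : ∀ φ y {i} → y X.≈ x i → bar φ y X.≈ x i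
    bar-x φ y {i} y≈xᵢ = begin
      bar φ y   ≈⟨ bar-at φ y {i} y≈xᵢ ⟩
      y         ≈⟨ y≈xᵢ ⟩
      x i       ∎
      where open X-Reasoning

    bar-unique : ∀ φ y z → Away y → Away z →
      (∀ f g → θ y f g → θ z (φ ·D f) (φ ·D g)) → bar φ y X.≈ z
    bar-unique φ y z y-away z-away z-spec = begin
      bar φ y                       ≈⟨ bar-away φ y y-away ⟩
      proj₁ (move φ (y , y-away))   ≈⟨ move-unique φ (y , y-away) z z-away z-spec ⟨
      z                             ∎
      where open X-Reasoning

    bar-cong : ∀ φ χ y z → φ AutD.≈ χ → y X.≈ z → bar φ y X.≈ bar χ z
    bar-cong φ χ y z φ≈χ y≈z = by-location z
      (λ i z≈xᵢ → begin
        bar φ y   ≈⟨ bar-x φ y {i} (X.trans {y} {z} {x i} y≈z z≈xᵢ) ⟩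
        x i       ≈⟨ bar-x χ z {i} z≈xᵢ ⟨
        bar χ z   ∎)
      (λ z-away → let y-away = away-resp y≈z z-away in begin
        bar φ y                       ≈⟨ bar-away φ y y-away ⟩
        proj₁ (move φ (y , y-away))   ≈⟨ move-cong {φ} {χ} (y , y-away) (z , z-away) φ≈χ y≈z ⟩
        proj₁ (move χ (z , z-away))   ≈⟨ bar-away χ z z-away ⟨
        bar χ z                       ∎)
      where
      open X-Reasoning

      away-resp : y X.≈ z → Away z → Away y
      away-resp y≈z z-away i y≈xᵢ =
        z-away i (X.trans {z} {y} {x i} (X.sym {y} {z} y≈z) y≈xᵢ)

    bar-∙ : ∀ φ χ y → bar (φ AutD.∙ χ) y X.≈ bar φ (bar χ y)
    bar-∙ φ χ y = by-location y
      (λ i y≈xᵢ → begin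
        bar (φ AutD.∙ χ) y    ≈⟨ bar-x (φ AutD.∙ χ) y {i} y≈xᵢ ⟩
        x i                   ≈⟨ bar-x φ (bar χ y) {i} (bar-x χ y {i} y≈xᵢ) ⟨
        bar φ (bar χ y)       ∎)
      (λ y-away → let χy = move χ (y , y-away) in begin
        bar (φ AutD.∙ χ) y                       ≈⟨ bar-away (φ AutD.∙ χ) y y-away ⟩
        proj₁ (move (φ AutD.∙ χ) (y , y-away))   ≈⟨ move-∙ φ χ (y , y-away) ⟨
        proj₁ (move φ χy)                        ≈⟨ bar-away φ (proj₁ χy) (proj₂ χy) ⟨
        bar φ (proj₁ χy)
          ≈⟨ bar-cong φ φ (bar χ y) (proj₁ χy) (AutD.refl {φ}) (bar-away χ y y-away) ⟨
        bar φ (bar χ y)                          ∎)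
      where open X-Reasoning

    bar-ε : ∀ y → bar AutD.ε y X.≈ y
    bar-ε y = by-location y
      (λ i y≈xᵢ → bar-at AutD.ε y {i} y≈xᵢ)
      (λ y-away → bar-unique AutD.ε y y y-away y-away λ f g f~g → f~g)

    bar-inverse : ∀ φ χ → φ AutD.∙ χ AutD.≈ AutD.ε → ∀ {y z} → z X.≈ bar χ y → bar φ z X.≈ y
    bar-inverse φ χ φχ≈ε {y} {z} z≈χy = begin
      bar φ z               ≈⟨ bar-cong φ φ z (bar χ y) (AutD.refl {φ}) z≈χy ⟩
      bar φ (bar χ y)       ≈⟨ bar-∙ φ χ y ⟨
      bar (φ AutD.∙ χ) y    ≈⟨ bar-cong (φ AutD.∙ χ) AutD.ε y y φχ≈ε (X.refl {y}) ⟩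
      bar AutD.ε y          ≈⟨ bar-ε y ⟩
      y                     ∎
      where open X-Reasoning

  -- Two elements which differ exactly off the neighbourhoods of the `x j` pull back
  -- under `φ` to elements agreeing near `x i`, so near `x i` points are moved into some
  -- neighbourhood of an `x j`; there the first element is `e j`, while its pullback
  -- is `e i` near `x i`, so that `i ≡ j`.
  module NearFixed (φ : AutD.Carrier) (i : Fin n) (c : Clopen) (xᵢ∋c : x i ∋ c) where

    -- The condition confines the neighbourhood of `x i` to `c` and leaves the other neighbourhoods
    -- free.
    near-target : ∀ j → X.Near (x j) (λ z → j ≡ i → z ∋ c)
    near-target j with em {P = j ≡ i}
    ... | yes ≡.refl = X.near-map (x i) (λ _ z∋c _ → z∋c) (near-in {x i} xᵢ∋c)
    ... | no  j≢i    = near-everywhere (x j) λ _ j≡i → ⊥-elim (j≢i j≡i)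

    N : DisjointNeighbourhoods (λ j z → j ≡ i → z ∋ c)
    N = disjointNeighbourhoods near-target

    open DisjointNeighbourhoods N

    f g : D.Carrier
    f = patched N (const-lc a₀)
    g = patched N (const-lc a₁)

    Good : X.Carrier → Set _
    Good z = θ z (φ ⁻ ·D f) (φ ⁻ ·D g) × π z (φ ⁻ ·D f) A.≈ π (x i) (φ ⁻ ·D f)

    good-near : X.Near (x i) Good
    good-near = X.near-∩ (x i)
      (agree-near (φ ⁻ ·D f) (φ ⁻ ·D g) (x i)
        (A.trans (proj₂ (φ ⁻ ·D f) i) (A.sym (proj₂ (φ ⁻ ·D g) i))))
      (π-lc (φ ⁻ ·D f) (x i))

    good-moves-into-c : ∀ z (z-away : Away z) → Good z → proj₁ (move φ (z , z-away)) ∋ c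
    good-moves-into-c z z-away (f~g , f≈eᵢ) = [ inside , outside ]′ (cover? w)
      where
      open A-Reasoning

      z° : X°.Carrier
      z° = z , z-away
      w : X.Carrier
      w = proj₁ (move φ z°)

      inside : (∃[ j ] w ∋ nbhd j) → w ∋ c
      inside (j , w∋nbhd) = within j w w∋nbhd (≡.sym (distinct-orbits i j (fibre φ z° , (begin
        fibre φ z° ·A e i
          ≈⟨ ·A-cong (fibre φ z°) (A.trans f≈eᵢ (proj₂ (φ ⁻ ·D f) i)) ⟨
        fibre φ z° ·A π z (φ ⁻ ·D f)      ≈⟨ fibre-spec⁻ φ z° f ⟩
        π w f                             ≈⟨ π-patched-in N (const-lc a₀) j w w∋nbhd ⟩
        e j                               ∎))))

      outside : (∀ j → w ∌ nbhd j) → w ∋ c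
      outside w-out = ⊥-elim (a₀≉a₁ (begin
        a₀      ≈⟨ π-patched-out N (const-lc a₀) w w-out ⟨
        π w f   ≈⟨ θ-move⁻ φ z° f g f~g ⟩
        π w g   ≈⟨ π-patched-out N (const-lc a₁) w w-out ⟩
        a₁      ∎))

    near-fixed : X.Near (x i) (λ z → bar φ z ∋ c)
    near-fixed = X.near-map (x i) bar-in (X.near-∩ (x i) (near-in {x i} xᵢ∋c) good-near)
      where
      bar-in : ∀ z → z ∋ c × Good z → bar φ z ∋ c
      bar-in z (z∋c , good) = by-location z
        (λ j z≈xⱼ → X.base-resp c z (bar φ z) (X.sym {bar φ z} {z} (bar-at φ z {j} z≈xⱼ)) z∋c)
        (λ z-away → let w = proj₁ (move φ (z , z-away)) in
          X.base-resp c w (bar φ z) (X.sym {bar φ z} {w} (bar-away φ z z-away))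
            (good-moves-into-c z z-away good))

  bar-near : ∀ φ y c → bar φ y ∋ c → X.Near y (λ z → bar φ z ∋ c)
  bar-near φ y c φy∋c = by-location y near-at near-away
    where
    near-at : ∀ i → y X.≈ x i → X.Near y (λ z → bar φ z ∋ c)
    near-at i y≈xᵢ = near-resp {y = x i} {y} (X.sym {y} {x i} y≈xᵢ)
      (NearFixed.near-fixed φ i c (X.base-resp c (bar φ y) (x i) (bar-x φ y {i} y≈xᵢ) φy∋c))

    near-away : Away y → X.Near y (λ z → bar φ z ∋ c)
    near-away y-away =
      let d , y∋d , d⊆ = move-near φ (y , y-away) c (X.base-resp c (bar φ y)
            (proj₁ (move φ (y , y-away))) (bar-away φ y y-away) φy∋c)
      in X.near-map y
        (λ z (z∋d , z-away) → let w = proj₁ (move φ (z , z-away)) in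
          X.base-resp c w (bar φ z) (X.sym {bar φ z} {w} (bar-away φ z z-away))
            (d⊆ (z , z-away) z∋d))
        (X.near-∩ y (near-in {y} y∋d) (away-open y y-away))

  -- The epimorphism `h` and its section

  h : AutD.Carrier → HomeoX.Carrier
  h φ = (record
    { to        = bar φ
    ; from      = bar (φ ⁻)
    ; to-cong   = λ {y} {z} → bar-cong φ φ y z (AutD.refl {φ})
    ; from-cong = λ {y} {z} → bar-cong (φ ⁻) (φ ⁻) y z (AutD.refl {φ ⁻})
    ; inverse   = (λ {y} {z} → bar-inverse φ (φ ⁻) (AutD.inverseʳ φ) {y} {z})
                , (λ {y} {z} → bar-inverse (φ ⁻) φ (AutD.inverseˡ φ) {y} {z})
    } , continuous-from-base X X (bar φ) (bar-near φ)
      , continuous-from-base X X (bar (φ ⁻)) (bar-near (φ ⁻)))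
    , λ i → bar-x φ (x i) {i} (X.refl {x i})

  abstract

    h-hom : IsHom AutD HomeoX h
    h-hom = isHom AutD HomeoX h (λ {φ} {χ} φ≈χ y → bar-cong φ χ y y φ≈χ (X.refl {y})) bar-∙

  σσ⁻ : ∀ σ y → σ ·X (σ HomeoX.⁻¹) ·X y X.≈ y
  σσ⁻ σ = HomeoX.inverseʳ σ

  σ⁻σ : ∀ σ y → (σ HomeoX.⁻¹) ·X σ ·X y X.≈ y
  σ⁻σ σ = HomeoX.inverseˡ σ

  σ-x : ∀ (σ : HomeoX.Carrier) y {i} → y X.≈ x i → σ ·X y X.≈ x i
  σ-x σ y {i} y≈xᵢ = begin
    σ ·X y     ≈⟨ Inverse.to-cong (proj₁ (proj₁ σ)) {y} {x i} y≈xᵢ ⟩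
    σ ·X x i   ≈⟨ proj₂ σ i ⟩
    x i        ∎
    where open X-Reasoning

  σ-away : ∀ σ y → Away y → Away (σ ·X y)
  σ-away σ y y-away i σy≈xᵢ = y-away i (begin
    y                              ≈⟨ σ⁻σ σ y ⟨
    (σ HomeoX.⁻¹) ·X σ ·X y        ≈⟨ σ-x (σ HomeoX.⁻¹) (σ ·X y) {i} σy≈xᵢ ⟩
    x i                            ∎)
    where open X-Reasoning

  pullback : HomeoX.Carrier → D.Carrier → D.Carrier
  pullback σ f = element (λ y → π (σ ·X y) f)
    (λ y → let c , σy∋c , const = π-lc f (σ ·X y) in
      X.near-map y (λ z → const (σ ·X z))
        (proj₁ (proj₂ (proj₁ σ)) {λ z → z ∋ c} (λ _ z∋c → c , z∋c , λ _ w∋c → w∋c) y σy∋c))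
    (λ i → π-x f (proj₂ σ i))

  abstract

    -- Precomposition reverses products; composing with the inverse of `σ` restores their order.
    section : HomeoX.Carrier → AutD.Carrier
    section σ = record
      { to        = pullback (σ HomeoX.⁻¹)
      ; from      = pullback σ
      ; to-cong   = λ f≈g y → f≈g _
      ; from-cong = λ f≈g y → f≈g _
      ; inverse   = (λ {f} {g} g≈ y → A.trans (g≈ _) (π-cong f _ _ (σσ⁻ σ y)))
                  , (λ {f} {g} g≈ y → A.trans (g≈ _) (π-cong f _ _ (σ⁻σ σ y)))
      } , λ o v y → A.refl

    section-hom : IsHom HomeoX AutD section
    section-hom = isHom HomeoX AutD section
      (λ {σ} {τ} σ≈τ f y → π-cong f _ _ (HomeoX.⁻¹-cong {σ} {τ} σ≈τ y))
      (λ σ τ f y → A.refl)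

    h-section : ∀ σ → h (section σ) HomeoX.≈ σ
    h-section σ y = by-location y
      (λ i y≈xᵢ → begin
        bar (section σ) y   ≈⟨ bar-x (section σ) y {i} y≈xᵢ ⟩
        x i                 ≈⟨ σ-x σ y {i} y≈xᵢ ⟨
        σ ·X y              ∎)
      (λ y-away → bar-unique (section σ) y (σ ·X y) y-away (σ-away σ y y-away) λ f g f~g →
        A.trans (π-cong f _ _ (σ⁻σ σ y)) (A.trans f~g (A.sym (π-cong g _ _ (σ⁻σ σ y)))))
      where open X-Reasoning

    h-surjective : ∀ σ → ∃[ φ ] (∀ {χ} → χ AutD.≈ φ → h χ HomeoX.≈ σ)
    h-surjective σ = section σ , λ {χ} χ≈ y → begin
      bar χ y             ≈⟨ bar-cong χ (section σ) y y χ≈ (X.refl {y}) ⟩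
      bar (section σ) y   ≈⟨ h-section σ y ⟩
      σ ·X y              ∎
      where open X-Reasoning

  -- The kernel of `h` and the map `p`

  ker-h : Group _ _
  ker-h = kernel AutD HomeoX h-hom

  private module ker-h = Group ker-h

  move-ker : ∀ (φ : ker-h.Carrier) y → proj₁ (move (proj₁ φ) y) X.≈ proj₁ y
  move-ker (φ , φ∈ker) (y , y-away) = begin
    proj₁ (move φ (y , y-away))   ≈⟨ bar-away φ y y-away ⟨
    bar φ y                       ≈⟨ φ∈ker y ⟩
    y                             ∎
    where open X-Reasoning

  fibre-ker : ∀ (φ : ker-h.Carrier) y f →
    fibre (proj₁ φ) y ·A π (proj₁ y) f A.≈ π (proj₁ y) (proj₁ φ ·D f)
  fibre-ker φ y f = A.trans (fibre-spec (proj₁ φ) y f)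
    (π-cong (proj₁ φ ·D f) (proj₁ (move (proj₁ φ) y)) (proj₁ y) (move-ker φ y))

  -- Every element of `A` is the value at `y` of some element of `D`. Statements about `fibre` can
  -- therefore be checked on such values, where `fibre-ker` applies.
  through-induction : ∀ {p} (P : A.Carrier → Set p) y → Away y →
    (∀ {u v} → u A.≈ v → P u → P v) → (∀ f → P (π y f)) → ∀ u → P u
  through-induction P y y-away resp Pπ u = resp (π-through u) (Pπ (through u))
    where open Avoiding y y-away

  -- One neighbourhood for each element of the enumeration of `A` is intersected; `P` has to respect
  -- `≈` because the enumeration reaches every element up to `≈`.
  near-finite : ∀ {p} y (P : A.Carrier → X.Carrier → Set p) →
    (∀ {u v} → u A.≈ v → ∀ z → P u z → P v z) →
    (∀ u → X.Near y (P u)) → X.Near y (λ z → ∀ u → P u z)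
  near-finite y P resp near = X.near-map y
    (λ z p u → resp (Inverse.inverseʳ (proj₂ finite) ≡.refl) z (p (Inverse.to (proj₂ finite) u)))
    (X.near-⋂ y (λ j → near (Inverse.from (proj₂ finite) j)))

  -- Both `f` and its image under `φ` are constant near `y`, and by `fibre-ker` the automorphisms at
  -- nearby points all carry the one value to the other.
  fibre-near : ∀ (φ : ker-h.Carrier) y → X.Near (proj₁ y)
    (λ z → ∀ u (z-away : Away z) → fibre (proj₁ φ) (z , z-away) ·A u A.≈ fibre (proj₁ φ) y ·A u)
  fibre-near φ (y , y-away) = near-finite y
    (λ u z → (z-away : Away z) → fibre (proj₁ φ) (z , z-away) ·A u A.≈ fibre (proj₁ φ) y° ·A u)
    (λ {u} {v} u≈v z p z-away → A.trans (·A-cong (fibre (proj₁ φ) (z , z-away)) (A.sym u≈v))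
      (A.trans (p z-away) (·A-cong (fibre (proj₁ φ) y°) u≈v)))
    (through-induction _ y y-away
      (λ {u} {v} u≈v → X.near-map y λ z p z-away →
        A.trans (·A-cong (fibre (proj₁ φ) (z , z-away)) (A.sym u≈v))
          (A.trans (p z-away) (·A-cong (fibre (proj₁ φ) y°) u≈v)))
      λ f → X.near-map y (λ z (f≈ , φf≈) z-away → begin
          fibre (proj₁ φ) (z , z-away) ·A π y f  ≈⟨ ·A-cong (fibre (proj₁ φ) (z , z-away)) f≈ ⟨
          fibre (proj₁ φ) (z , z-away) ·A π z f  ≈⟨ fibre-ker φ (z , z-away) f ⟩
          π z (proj₁ φ ·D f)                     ≈⟨ φf≈ ⟩
          π y (proj₁ φ ·D f)                     ≈⟨ fibre-ker φ y° f ⟨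
          fibre (proj₁ φ) y° ·A π y f            ∎)
        (X.near-∩ y (π-lc f y) (π-lc (proj₁ φ ·D f) y)))
    where
    open A-Reasoning

    y° : X°.Carrier
    y° = y , y-away

  fibre-lc : ∀ (φ : ker-h.Carrier) → LocallyConstant X° AutA.setoid (fibre (proj₁ φ))
  fibre-lc φ y = let c , y∋c , const = fibre-near φ y in
    c , y∋c , λ z z∋c u → const (proj₁ z) z∋c u (proj₂ z)

  someElement : D.Carrier
  someElement = patched (disjointNeighbourhoods {P = λ _ z → z X.≈ z}
    λ i → near-everywhere (x i) (λ z → X.refl {z})) (const-lc a₀)

  -- Any element of `D` and its image under `φ` are both `e i` near `x i`, and the fibre
  -- automorphism carries the one value to the other; `someElement` serves as such an element.
  fibre-stab : ∀ (φ : ker-h.Carrier) i → X.Near (x i) (stabSet (fibre (proj₁ φ)) i)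
  fibre-stab φ i = X.near-map (x i) stab
    (X.near-∩ (x i) (isolated i)
      (X.near-∩ (x i) (π-lc someElement (x i)) (π-lc (proj₁ φ ·D someElement) (x i))))
    where
    open A-Reasoning

    stab : ∀ z → (∀ j → z X.≈ x j → i ≡ j) × (π z someElement A.≈ π (x i) someElement)
      × (π z (proj₁ φ ·D someElement) A.≈ π (x i) (proj₁ φ ·D someElement)) →
      z ∈ stabSet (fibre (proj₁ φ)) i
    stab z (isol , f≈ , φf≈) = by-location z
      (λ j z≈xⱼ → inj₂ (≡.subst (λ k → z X.≈ x k) (≡.sym (isol j z≈xⱼ)) z≈xⱼ))
      (λ z-away → inj₁ (z-away , (begin
        fibre (proj₁ φ) (z , z-away) ·A e i
          ≈⟨ ·A-cong (fibre (proj₁ φ) (z , z-away)) (A.trans f≈ (proj₂ someElement i)) ⟨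
        fibre (proj₁ φ) (z , z-away) ·A π z someElement
          ≈⟨ fibre-ker φ (z , z-away) someElement ⟩
        π z (proj₁ φ ·D someElement)
          ≈⟨ A.trans φf≈ (proj₂ (proj₁ φ ·D someElement) i) ⟩
        e i ∎)))

  abstract

    fibre-InK : ∀ (φ : ker-h.Carrier) → InK (fibre (proj₁ φ))
    fibre-InK φ = record
      { continuous = locallyConstant⇒continuous X° AutA.setoid {fibre (proj₁ φ)} (fibre-lc φ)
      ; open-stab  = λ
        { i y (inj₂ y≈xᵢ) → near-resp {y = x i} {y} (X.sym {y} {x i} y≈xᵢ) (fibre-stab φ i)
        ; i y (inj₁ (y-away , fixes)) → X.near-map y
            (λ z (z-away , const) → inj₁ (z-away , A.trans (const (e i) z-away) fixes))
            (X.near-∩ y (away-open y y-away) (fibre-near φ (y , y-away)))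
        }
      }

  p : ker-h.Carrier → K.Carrier
  p φ = fibre (proj₁ φ) , fibre-InK φ

  p-cong : ∀ {φ χ} → φ ker-h.≈ χ → p φ K.≈ p χ
  p-cong {φ} {χ} φ≈χ y = through-induction
    (λ u → fibre (proj₁ φ) y ·A u A.≈ fibre (proj₁ χ) y ·A u) (proj₁ y) (proj₂ y)
    (λ u≈v q → A.trans (·A-cong (fibre (proj₁ φ) y) (A.sym u≈v))
      (A.trans q (·A-cong (fibre (proj₁ χ) y) u≈v)))
    λ f → A.trans (fibre-ker φ y f) (A.trans (φ≈χ f (proj₁ y)) (A.sym (fibre-ker χ y f)))

  p-∙ : ∀ φ χ → p (φ ker-h.∙ χ) K.≈ p φ K.∙ p χ
  p-∙ φ χ y = through-induction
    (λ u → fibre (proj₁ φ AutD.∙ proj₁ χ) y ·A u A.≈ fibre (proj₁ φ) y ·A fibre (proj₁ χ) y ·A u)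
    (proj₁ y) (proj₂ y)
    (λ u≈v q → A.trans (·A-cong (fibre (proj₁ φ AutD.∙ proj₁ χ) y) (A.sym u≈v))
      (A.trans q (·A-cong (fibre (proj₁ φ) y) (·A-cong (fibre (proj₁ χ) y) u≈v))))
    λ f → A.trans (fibre-ker (φ ker-h.∙ χ) y f) (A.trans
      (A.sym (fibre-ker φ y (proj₁ χ ·D f)))
      (·A-cong (fibre (proj₁ φ) y) (A.sym (fibre-ker χ y f))))

  p-injective : ∀ {φ χ} → p φ K.≈ p χ → φ ker-h.≈ χ
  p-injective {φ} {χ} pφ≈pχ f y = by-location y
    (λ i y≈xᵢ → A.trans (π-x (proj₁ φ ·D f) y≈xᵢ) (A.sym (π-x (proj₁ χ ·D f) y≈xᵢ)))
    (λ y-away → A.trans (A.sym (fibre-ker φ (y , y-away) f))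
      (A.trans (pφ≈pχ (y , y-away) (π y f)) (fibre-ker χ (y , y-away) f)))

  -- Twisting by an element of `K`

  module Twist (ψ : K.Carrier) where

    ψ-lc : LocallyConstant X° AutA.setoid (proj₁ ψ)
    ψ-lc = continuous⇒locallyConstant X° AutA.setoid {proj₁ ψ} (InK.continuous (proj₂ ψ))

    -- The decision is an argument so that facts about `twist` can be proved for an arbitrary
    -- decision and then specialised to `em`.
    twist? : D.Carrier → ∀ y → Dec (Away y) → A.Carrier
    twist? f y (yes y-away) = proj₁ ψ (y , y-away) ·A π y f
    twist? f y (no _)       = π y f

    twist : D.Carrier → X.Carrier → A.Carrier
    twist f y = twist? f y em

    abstract

      twist-away : ∀ f y (y-away : Away y) → twist f y A.≈ proj₁ ψ (y , y-away) ·A π y f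
      twist-away f y y-away = lemma em
        where
        lemma : ∀ d → twist? f y d A.≈ proj₁ ψ (y , y-away) ·A π y f
        lemma (yes y-away′) = locallyConstant⇒cong X° AutA.setoid {proj₁ ψ} ψ-lc
          (y , y-away′) (y , y-away) (X.refl {y}) (π y f)
        lemma (no ¬away)    = ⊥-elim (¬away y-away)

      twist-at : ∀ f y {i} → y X.≈ x i → twist f y A.≈ e i
      twist-at f y {i} y≈xᵢ = lemma em
        where
        lemma : ∀ d → twist? f y d A.≈ e i
        lemma (yes y-away) = ⊥-elim (y-away i y≈xᵢ)
        lemma (no _)       = π-x f y≈xᵢ

    -- At `x i` this is what `open-stab` provides: near `x i` the element `f` has the value `e i`,
    -- and `ψ` fixes `e i` there. At points of `X°` both `ψ` and `f` are locally constant.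
    twist-lc : ∀ f → LocallyConstant X A.setoid (twist f)
    twist-lc f y = by-location y near-at near-away
      where
      open A-Reasoning

      near-at : ∀ i → y X.≈ x i → X.Near y (λ z → twist f z A.≈ twist f y)
      near-at i y≈xᵢ = X.near-map y
        (λ { z (inj₁ (z-away , fixes) , f≈) → begin
              twist f z                       ≈⟨ twist-away f z z-away ⟩
              proj₁ ψ (z , z-away) ·A π z f
                ≈⟨ ·A-cong (proj₁ ψ (z , z-away)) (A.trans f≈ (π-x f y≈xᵢ)) ⟩
              proj₁ ψ (z , z-away) ·A e i     ≈⟨ fixes ⟩
              e i                             ≈⟨ twist-at f y y≈xᵢ ⟨
              twist f y                       ∎
           ; z (inj₂ z≈xᵢ , _) → A.trans (twist-at f z z≈xᵢ) (A.sym (twist-at f y y≈xᵢ)) })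
        (X.near-∩ y (InK.open-stab (proj₂ ψ) i y (inj₂ y≈xᵢ)) (π-lc f y))

      near-away : Away y → X.Near y (λ z → twist f z A.≈ twist f y)
      near-away y-away = let c , y∋c , const = ψ-lc (y , y-away) in X.near-map y
        (λ z (z∋c , z-away , f≈) → begin
          twist f z                       ≈⟨ twist-away f z z-away ⟩
          proj₁ ψ (z , z-away) ·A π z f   ≈⟨ ·A-cong (proj₁ ψ (z , z-away)) f≈ ⟩
          proj₁ ψ (z , z-away) ·A π y f   ≈⟨ const (z , z-away) z∋c (π y f) ⟩
          proj₁ ψ (y , y-away) ·A π y f   ≈⟨ twist-away f y y-away ⟨
          twist f y                       ∎)
        (X.near-∩ y (near-in {y} y∋c) (X.near-∩ y (away-open y y-away) (π-lc f y)))

    twisted : D.Carrier → D.Carrier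
    twisted f = element (twist f) (twist-lc f) (λ i → twist-at f (x i) (X.refl {x i}))

    twisted-cong : ∀ {f g} y → π y f A.≈ π y g → π y (twisted f) A.≈ π y (twisted g)
    twisted-cong {f} {g} y f≈g = by-location y
      (λ i y≈xᵢ → A.trans (twist-at f y y≈xᵢ) (A.sym (twist-at g y y≈xᵢ)))
      (λ y-away → A.trans (twist-away f y y-away) (A.trans
        (·A-cong (proj₁ ψ (y , y-away)) f≈g) (A.sym (twist-away g y y-away))))

    twisted-op : ∀ o v → twisted (D.op o v) D.≈ D.op o (twisted ∘ v)
    twisted-op o v y = by-location y
      (λ i y≈xᵢ → A.trans (twist-at (D.op o v) y y≈xᵢ)
        (A.sym (π-x (D.op o (twisted ∘ v)) y≈xᵢ)))
      (λ y-away → A.trans (twist-away (D.op o v) y y-away) (A.trans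
        (proj₂ (proj₁ ψ (y , y-away)) o (λ j → π y (v j)))
        (A.op-cong o λ j → A.sym (twist-away (v j) y y-away))))

  open Twist using (twist; twist-away; twisted; twisted-cong; twisted-op)

  twisted-cancel : ∀ ψ χ → (∀ y u → proj₁ ψ y ·A proj₁ χ y ·A u A.≈ u) →
    ∀ f → twisted ψ (twisted χ f) D.≈ f
  twisted-cancel ψ χ ψχ≈id f y = by-location y
    (λ i y≈xᵢ → A.trans (π-x (twisted ψ (twisted χ f)) y≈xᵢ) (A.sym (π-x f y≈xᵢ)))
    (λ y-away → begin
      twist ψ (twisted χ f) y                     ≈⟨ twist-away ψ (twisted χ f) y y-away ⟩
      proj₁ ψ (y , y-away) ·A twist χ f y
        ≈⟨ ·A-cong (proj₁ ψ (y , y-away)) (twist-away χ f y y-away) ⟩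
      proj₁ ψ (y , y-away) ·A proj₁ χ (y , y-away) ·A π y f
                                                  ≈⟨ ψχ≈id (y , y-away) (π y f) ⟩
      π y f                                       ∎)
    where open A-Reasoning

  untwist : K.Carrier → ker-h.Carrier
  untwist ψ = φ , λ y → by-location y
    (λ i y≈xᵢ → bar-at φ y {i} y≈xᵢ)
    -- A pointwise action preserves agreement at `y`, so `y` is not moved.
    (λ y-away → bar-unique φ y y y-away y-away λ f g → twisted-cong ψ {f} {g} y)
    where
    φ : AutD.Carrier
    φ = record
      { to        = twisted ψ
      ; from      = twisted (ψ K.⁻¹)
      ; to-cong   = λ {f} {g} f≈g y → twisted-cong ψ {f} {g} y (f≈g y)
      ; from-cong = λ {f} {g} f≈g y → twisted-cong (ψ K.⁻¹) {f} {g} y (f≈g y)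
      ; inverse   =
          (λ {f} {g} g≈ y → A.trans (twisted-cong ψ {g} {twisted (ψ K.⁻¹) f} y (g≈ y))
            (twisted-cancel ψ (ψ K.⁻¹) (λ y → AutA.inverseʳ (proj₁ ψ y)) f y))
        , (λ {f} {g} g≈ y → A.trans (twisted-cong (ψ K.⁻¹) {g} {twisted ψ f} y (g≈ y))
            (twisted-cancel (ψ K.⁻¹) ψ (λ y → AutA.inverseˡ (proj₁ ψ y)) f y))
      } , twisted-op ψ

  p-untwist : ∀ ψ → p (untwist ψ) K.≈ ψ
  p-untwist ψ y u = A.sym (fibre-unique (proj₁ (untwist ψ)) y (proj₁ ψ y)
    (λ f → A.trans (A.sym (twist-away ψ f (proj₁ y) (proj₂ y)))
      (A.sym (π-cong (twisted ψ f) (proj₁ (move (proj₁ (untwist ψ)) y)) (proj₁ y)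
        (move-ker (untwist ψ) y)))) u)

  abstract

    p-iso : IsIso ker-h K p
    p-iso = record
      { isGroupMonomorphism = record
        { isGroupHomomorphism = isHom ker-h K p (λ {φ} {χ} → p-cong {φ} {χ}) p-∙
        ; injective = λ {φ} {χ} → p-injective {φ} {χ}
        }
      ; surjective = λ ψ → untwist ψ , λ {φ} φ≈ y u →
          A.trans (p-cong {φ} {untwist ψ} φ≈ y u) (p-untwist ψ y u)
      }

theorem3p6 : (em : Classical) →
    ∀ {s a ℓa b ℓb} {S : Signature s} (A : Algebra S a ℓa) →
    Finite (Algebra.setoid A) → Simple A → Mal'cev A → ¬ Abelian A →
    ∀ {n} (e : Fin n → Algebra.Carrier A) (e-idem : ∀ i → IsIdempotent A (e i)) →
    (∀ i j → SameOrbit A (e i) (e j) → i ≡ j) →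
    (B : BooleanAlgebra b ℓb) (x : Fin n → Ultrafilter B) →
    (∀ i j → Space._≈_ (StoneSpace B) (x i) (x j) → i ≡ j) →
    let open FilteredPower em A B e e-idem x in
    Σ[ M ∈ InducedMaps ]
    let open InducedMaps M in
    Σ[ h ∈ (AutD.Carrier → HomeoX.Carrier) ]
    Σ[ h-epi ∈ IsEpi AutD HomeoX h ]
    let ker-h = kernel AutD HomeoX (proj₁ h-epi) in
    (∀ φ y → h φ ·X y X.≈ bar φ y)
    × (∃[ α ] AutD ≅ semidirect ker-h HomeoX α)
    × (Σ[ p ∈ (Group.Carrier ker-h → Group.Carrier K) ]
    (∀ φ y → proj₁ (p φ) y AutA.≈ proj₁ φ ₍ y ₎)
    × IsIso ker-h K p)
theorem3p6 em A finite simple mal nonabelian e e-idem distinct-orbits B x x-distinct =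
  inducedMaps , h , (h-hom , h-surjective) ,
  (λ φ y → Space.refl (StoneSpace B) {bar φ y}) ,
  -- `SE.action` is restated field by field: converting its type as a whole makes Agda unfold
  -- the group of automorphisms of `ker h`.
  (record
    { ⟦_⟧ = α.⟦_⟧
    ; isGroupHomomorphism = record
      { isMonoidHomomorphism = record
        { isMagmaHomomorphism = record
          { isRelHomomorphism = record { cong = λ {σ} {τ} → α.⟦⟧-cong {σ} {τ} }
          ; homo = α.homo
          }
        ; ε-homo = α.ε-homo
        }
      ; ⁻¹-homo = α.⁻¹-homo
      }
    } , SE.G≅N⋊H) ,
  (p , (λ φ y u → Algebra.refl A) , p-iso)
  where
  open AutomorphismsOfFilteredPower em A finite simple mal nonabelian e e-idem distinct-orbits
    B x x-distinct
  open FilteredPower em A B e e-idem x using (AutD; HomeoX)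
  module SE = SplitExtension AutD HomeoX h h-hom section section-hom h-section
  module α = GroupHomomorphism SE.action
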